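{- Suppose the angles in a spherical tiling by $12$ angle congruent pentagons are $\alpha,\beta,\gamma,\delta,\epsilon$, with $\alpha=\frac{2\pi}{3}$ and all five angles distinct. Then, up to symmetry, the tiling must have anglewise vertex combination $\{2\alpha^3,6\alpha\gamma\epsilon,6\beta^2\gamma,6\delta^2\epsilon\}$ and is given by one of the following four tilings (angle words on the dodecahedral pattern, as explained in the context). (i) $P_1:\alpha\beta\epsilon\delta\gamma$; $P_2:\alpha\beta\epsilon\delta\gamma$; $P_3:\epsilon\delta\gamma\alpha\beta$; $P_4:\gamma\alpha\beta\epsilon\delta$; $P_5:\delta\gamma\alpha\beta\epsilon$; $P_6:\delta\gamma\alpha\beta\epsilon$; $P_7:\alpha\beta\epsilon\delta\gamma$; $P_8:\delta\gamma\alpha\beta\epsilon$; $P_9:\delta\gamma\alpha\beta\epsilon$; $P_{10}:\gamma\alpha\beta\epsilon\delta$; $P_{11}:\epsilon\delta\gamma\alpha\beta$; $P_{12}:\alpha\beta\epsilon\delta\gamma$. (ii) $P_1:\alpha\beta\delta\epsilon\gamma$; $P_2:\alpha\beta\delta\epsilon\gamma$; $P_3:\epsilon\delta\beta\alpha\gamma$; $P_4:\beta\alpha\gamma\epsilon\delta$; $P_5:\epsilon\gamma\alpha\beta\delta$; $P_6:\delta\beta\alpha\gamma\epsilon$; $P_7:\alpha\beta\delta\epsilon\gamma$; $P_8:\delta\beta\alpha\gamma\epsilon$; $P_9:\epsilon\gamma\alpha\beta\delta$; $P_{10}:\beta\alpha\gamma\epsilon\delta$; $P_{11}:\epsilon\delta\beta\alpha\gamma$;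 $P_{12}:\alpha\beta\delta\epsilon\gamma$. (iii) $P_1:\alpha\gamma\beta\delta\epsilon$; $P_2:\delta\beta\gamma\alpha\epsilon$; $P_3:\gamma\alpha\epsilon\delta\beta$; $P_4:\beta\delta\epsilon\alpha\gamma$; $P_5:\beta\gamma\alpha\epsilon\delta$; $P_6:\epsilon\alpha\gamma\beta\delta$; $P_7:\beta\gamma\alpha\epsilon\delta$; $P_8:\beta\delta\epsilon\alpha\gamma$; $P_9:\gamma\alpha\epsilon\delta\beta$; $P_{10}:\delta\beta\gamma\alpha\epsilon$; $P_{11}:\epsilon\alpha\gamma\beta\delta$; $P_{12}:\delta\epsilon\alpha\gamma\beta$. (iv) $P_1:\alpha\epsilon\beta\delta\gamma$; $P_2:\beta\delta\gamma\alpha\epsilon$; $P_3:\gamma\alpha\epsilon\beta\delta$; $P_4:\delta\beta\epsilon\alpha\gamma$; $P_5:\beta\epsilon\alpha\gamma\delta$; $P_6:\epsilon\alpha\gamma\delta\beta$; $P_7:\delta\gamma\alpha\epsilon\beta$; $P_8:\beta\delta\gamma\alpha\epsilon$; $P_9:\epsilon\alpha\gamma\delta\beta$; $P_{10}:\delta\beta\epsilon\alpha\gamma$; $P_{11}:\gamma\alpha\epsilon\beta\delta$; $P_{12}:\beta\epsilon\alpha\gamma\delta$.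
   Context: A spherical tiling by $12$ pentagons (graph embedded in $S^2$ with all vertices of degree $\ge 3$, every tile a five-edged region enclosed by a simple closed curve; edges may be any nice curves) is combinatorially the dodecahedral pattern: tiles $P_1,\dots,P_{12}$, where $P_i$ with list $(n_1,\dots,n_5)$ has edges in counterclockwise order $E_{i,n_1},\dots,E_{i,n_5}$, $E_{i,j}=E_{j,i}$ being the common edge of $P_i$ and $P_j$, and (with $n_6=n_1$) $E_{i,n_k},E_{i,n_{k+1}}$ meet at the vertex $V_{i,n_k,n_{k+1}}$ of degree $3$ shared by $P_i,P_{n_k},P_{n_{k+1}}$: $P_1:(2,3,4,5,6)$; $P_2:(1,6,11,7,3)$; $P_3:(1,2,7,8,4)$; $P_4:(1,3,8,9,5)$; $P_5:(1,4,9,10,6)$; $P_6:(1,5,10,11,2)$; $P_7:(12,8,3,2,11)$; $P_8:(12,9,4,3,7)$; $P_9:(12,10,5,4,8)$; $P_{10}:(12,11,6,5,9)$; $P_{11}:(12,7,2,6,10)$; $P_{12}:(7,11,10,9,8)$. "$P_i:w_1w_2w_3w_4w_5$" means that the angle of $P_i$ at $V_{i,n_k,n_{k+1}}$ is $w_k$ for $k=1,\dots,5$. An angle congruent tiling is considered as an assignment of angles to all (tile, vertex) corners such that the angles at every vertex sum to $2\pi$ and any two tiles are angle congruent, i.e. there is an adjacency-preserving correspondence of their edges that preserves the angles between adjacent edges (reflections allowed). No geometric realization by great arcs is required. The anglewise vertex combination lists all vertices by the multiset of angles at them, with multiplicity: $\{2\alpha^3,6\alpha\gamma\epsilon,6\beta^2\gamma,6\delta^2\epsilon\}$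 means that there are exactly $2$ vertices with angles $\alpha,\alpha,\alpha$, $6$ with angles $\alpha,\gamma,\epsilon$, $6$ with angles $\beta,\beta,\gamma$, $6$ with angles $\delta,\delta,\epsilon$, and no others. "Up to symmetry" means up to symmetries of the dodecahedral pattern (including reflections) and up to renaming $\beta,\gamma,\delta,\epsilon$. -}

module Defs where

open import Algebra.Apartness.Bundles using (HeytingField; HeytingCommutativeRing)
open import Algebra.Bundles using (CommutativeRing)
import Algebra.Definitions.RawMonoid as RawMonoidDefinitions
import Data.Bool.Properties as Bool
open import Data.Fin using (Fin; zero; suc)
open import Data.Fin.Permutation using (Permutation′; _⟨$⟩ʳ_)
open import Data.Fin.Subset using (Subset; ⁅_⁆; _∪_)
open import Data.List as List using (List; []; _∷_; _++_)
import Data.List.Relation.Binary.Permutation.Setoid as Permutation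
open import Data.Product using (Σ-syntax; ∃-syntax; _×_; _,_)
open import Data.Sum using (_⊎_)
open import Data.Vec as Vec using (Vec; []; _∷_)
import Data.Vec.Properties as Vec
open import Function using (_↔_; Inverse)
open import Level using (_⊔_) renaming (suc to lsuc)
open import Relation.Binary using (Rel; IsStrictPartialOrder; DecidableEquality)
open import Relation.Binary.PropositionalEquality using (_≡_; _≢_)
open import Relation.Nullary using (¬_)

-- The axioms are those of a constructive ordered field, so that the real
-- numbers are a model both constructively (with x # y meaning x < y or
-- y < x) and classically.
record OrderedField c ℓ₁ ℓ₂ ℓ₃ : Set (lsuc (c ⊔ ℓ₁ ⊔ ℓ₂ ⊔ ℓ₃)) where
  infix 4 _<_
  field
    heytingField : HeytingField c ℓ₁ ℓ₂

  open HeytingField heytingField public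

  field
    _<_                  : Rel Carrier ℓ₃
    isStrictPartialOrder : IsStrictPartialOrder _≈_ _<_
    #⇒<⊎>                : ∀ {x y} → x # y → x < y ⊎ y < x
    <⇒#                  : ∀ {x y} → x < y → x # y
    +-monoˡ-<            : ∀ z {x y} → x < y → x + z < y + z
    *-positive           : ∀ {x y} → 0# < x → 0# < y → 0# < x * y

  commutativeRing : CommutativeRing c ℓ₁
  commutativeRing = HeytingCommutativeRing.commutativeRing heytingCommutativeRing

pattern P₁ = zero
pattern P₂ = suc P₁
pattern P₃ = suc P₂
pattern P₄ = suc P₃
pattern P₅ = suc P₄
pattern P₆ = suc P₅
pattern P₇ = suc P₆
pattern P₈ = suc P₇
pattern P₉ = suc P₈
pattern P₁₀ = suc P₉
pattern P₁₁ = suc P₁₀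
pattern P₁₂ = suc P₁₁

neighbours : Vec (Vec (Fin 12) 5) 12
neighbours =
    (P₂ ∷ P₃ ∷ P₄ ∷ P₅ ∷ P₆ ∷ [])
  ∷ (P₁ ∷ P₆ ∷ P₁₁ ∷ P₇ ∷ P₃ ∷ [])
  ∷ (P₁ ∷ P₂ ∷ P₇ ∷ P₈ ∷ P₄ ∷ [])
  ∷ (P₁ ∷ P₃ ∷ P₈ ∷ P₉ ∷ P₅ ∷ [])
  ∷ (P₁ ∷ P₄ ∷ P₉ ∷ P₁₀ ∷ P₆ ∷ [])
  ∷ (P₁ ∷ P₅ ∷ P₁₀ ∷ P₁₁ ∷ P₂ ∷ [])
  ∷ (P₁₂ ∷ P₈ ∷ P₃ ∷ P₂ ∷ P₁₁ ∷ [])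
  ∷ (P₁₂ ∷ P₉ ∷ P₄ ∷ P₃ ∷ P₇ ∷ [])
  ∷ (P₁₂ ∷ P₁₀ ∷ P₅ ∷ P₄ ∷ P₈ ∷ [])
  ∷ (P₁₂ ∷ P₁₁ ∷ P₆ ∷ P₅ ∷ P₉ ∷ [])
  ∷ (P₁₂ ∷ P₇ ∷ P₂ ∷ P₆ ∷ P₁₀ ∷ [])
  ∷ (P₇ ∷ P₁₁ ∷ P₁₀ ∷ P₉ ∷ P₈ ∷ [])
  ∷ []

-- nbr i k is the tile across the k-th edge of tile i, in counterclockwise order.
nbr : Fin 12 → Fin 5 → Fin 12
nbr i k = Vec.lookup (Vec.lookup neighbours i) k

next : Fin 5 → Fin 5
next zero                         = suc zero
next (suc zero)                   = suc (suc zero)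
next (suc (suc zero))             = suc (suc (suc zero))
next (suc (suc (suc zero)))       = suc (suc (suc (suc zero)))
next (suc (suc (suc (suc zero)))) = zero

-- (i , k) is the corner of tile i between its k-th and (next k)-th edges.
Corner : Set
Corner = Fin 12 × Fin 5

corners : List Corner
corners = List.cartesianProduct (List.allFin 12) (List.allFin 5)

-- A vertex is identified with the set of the three tiles that share it.
Vertex : Set
Vertex = Subset 12

_≟ⱽ_ : DecidableEquality Vertex
_≟ⱽ_ = Vec.≡-dec Bool._≟_

V : Fin 12 → Fin 12 → Fin 12 → Vertex
V i j l = ⁅ i ⁆ ∪ ⁅ j ⁆ ∪ ⁅ l ⁆

vertex : Corner → Vertex
vertex (i , k) = V i (nbr i k) (nbr i (next k))

vertices : List Vertex
vertices = List.deduplicate _≟ⱽ_ (List.map vertex corners)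

cornersAt : Vertex → List Corner
cornersAt v = List.filter (λ c → vertex c ≟ⱽ v) corners

-- A symmetry of the pattern (possibly a reflection) permutes the tiles and
-- carries the corner (i , k), at the vertex V i j l, to the corner
-- (tile i , index i k), at the vertex V (tile i) (tile j) (tile l).
record Symmetry : Set where
  field
    tile   : Permutation′ 12
    index  : Fin 12 → Fin 5 → Fin 5
    vertex-preserving : ∀ i k →
      vertex (tile ⟨$⟩ʳ i , index i k) ≡
      V (tile ⟨$⟩ʳ i) (tile ⟨$⟩ʳ nbr i k) (tile ⟨$⟩ʳ nbr i (next k))

  corner : Corner → Corner
  corner (i , k) = tile ⟨$⟩ʳ i , index i k

data Name : Set where
  α β γ δ ε : Name

record Renaming : Set where
  field
    bijection : Name ↔ Name
    fixes-α   : Inverse.to bijection α ≡ α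

  rename : Name → Name
  rename = Inverse.to bijection

Words : Set
Words = Vec (Vec Name 5) 12

angleName : Words → Corner → Name
angleName w (i , k) = Vec.lookup (Vec.lookup w i) k

tiling-i : Words
tiling-i =
    (α ∷ β ∷ ε ∷ δ ∷ γ ∷ [])
  ∷ (α ∷ β ∷ ε ∷ δ ∷ γ ∷ [])
  ∷ (ε ∷ δ ∷ γ ∷ α ∷ β ∷ [])
  ∷ (γ ∷ α ∷ β ∷ ε ∷ δ ∷ [])
  ∷ (δ ∷ γ ∷ α ∷ β ∷ ε ∷ [])
  ∷ (δ ∷ γ ∷ α ∷ β ∷ ε ∷ [])
  ∷ (α ∷ β ∷ ε ∷ δ ∷ γ ∷ [])
  ∷ (δ ∷ γ ∷ α ∷ β ∷ ε ∷ [])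
  ∷ (δ ∷ γ ∷ α ∷ β ∷ ε ∷ [])
  ∷ (γ ∷ α ∷ β ∷ ε ∷ δ ∷ [])
  ∷ (ε ∷ δ ∷ γ ∷ α ∷ β ∷ [])
  ∷ (α ∷ β ∷ ε ∷ δ ∷ γ ∷ [])
  ∷ []

tiling-ii : Words
tiling-ii =
    (α ∷ β ∷ δ ∷ ε ∷ γ ∷ [])
  ∷ (α ∷ β ∷ δ ∷ ε ∷ γ ∷ [])
  ∷ (ε ∷ δ ∷ β ∷ α ∷ γ ∷ [])
  ∷ (β ∷ α ∷ γ ∷ ε ∷ δ ∷ [])
  ∷ (ε ∷ γ ∷ α ∷ β ∷ δ ∷ [])
  ∷ (δ ∷ β ∷ α ∷ γ ∷ ε ∷ [])
  ∷ (α ∷ β ∷ δ ∷ ε ∷ γ ∷ [])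
  ∷ (δ ∷ β ∷ α ∷ γ ∷ ε ∷ [])
  ∷ (ε ∷ γ ∷ α ∷ β ∷ δ ∷ [])
  ∷ (β ∷ α ∷ γ ∷ ε ∷ δ ∷ [])
  ∷ (ε ∷ δ ∷ β ∷ α ∷ γ ∷ [])
  ∷ (α ∷ β ∷ δ ∷ ε ∷ γ ∷ [])
  ∷ []

tiling-iii : Words
tiling-iii =
    (α ∷ γ ∷ β ∷ δ ∷ ε ∷ [])
  ∷ (δ ∷ β ∷ γ ∷ α ∷ ε ∷ [])
  ∷ (γ ∷ α ∷ ε ∷ δ ∷ β ∷ [])
  ∷ (β ∷ δ ∷ ε ∷ α ∷ γ ∷ [])
  ∷ (β ∷ γ ∷ α ∷ ε ∷ δ ∷ [])
  ∷ (ε ∷ α ∷ γ ∷ β ∷ δ ∷ [])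
  ∷ (β ∷ γ ∷ α ∷ ε ∷ δ ∷ [])
  ∷ (β ∷ δ ∷ ε ∷ α ∷ γ ∷ [])
  ∷ (γ ∷ α ∷ ε ∷ δ ∷ β ∷ [])
  ∷ (δ ∷ β ∷ γ ∷ α ∷ ε ∷ [])
  ∷ (ε ∷ α ∷ γ ∷ β ∷ δ ∷ [])
  ∷ (δ ∷ ε ∷ α ∷ γ ∷ β ∷ [])
  ∷ []

tiling-iv : Words
tiling-iv =
    (α ∷ ε ∷ β ∷ δ ∷ γ ∷ [])
  ∷ (β ∷ δ ∷ γ ∷ α ∷ ε ∷ [])
  ∷ (γ ∷ α ∷ ε ∷ β ∷ δ ∷ [])
  ∷ (δ ∷ β ∷ ε ∷ α ∷ γ ∷ [])
  ∷ (β ∷ ε ∷ α ∷ γ ∷ δ ∷ [])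
  ∷ (ε ∷ α ∷ γ ∷ δ ∷ β ∷ [])
  ∷ (δ ∷ γ ∷ α ∷ ε ∷ β ∷ [])
  ∷ (β ∷ δ ∷ γ ∷ α ∷ ε ∷ [])
  ∷ (ε ∷ α ∷ γ ∷ δ ∷ β ∷ [])
  ∷ (δ ∷ β ∷ ε ∷ α ∷ γ ∷ [])
  ∷ (γ ∷ α ∷ ε ∷ β ∷ δ ∷ [])
  ∷ (β ∷ ε ∷ α ∷ γ ∷ δ ∷ [])
  ∷ []
-- The k-th corner of a pentagon is the one where edges k and next k meet.
MeetAt : Fin 5 → Fin 5 → Fin 5 → Set
MeetAt e f k = (e ≡ k × f ≡ next k) ⊎ (f ≡ k × e ≡ next k)

module Angles {c ℓ₁ ℓ₂ ℓ₃} (F : OrderedField c ℓ₁ ℓ₂ ℓ₃) where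
  open OrderedField F
  open CommutativeRing commutativeRing using (+-rawMonoid)
  open RawMonoidDefinitions +-rawMonoid public using () renaming (_×_ to _·_)

  Assignment : Set c
  Assignment = Corner → Carrier

  anglesAt : Assignment → Vertex → List Carrier
  anglesAt angle v = List.map angle (cornersAt v)

  sum : List Carrier → Carrier
  sum = List.foldr _+_ 0#

  -- The correspondence takes edge k of the first pentagon to edge f k of the
  -- second; it may reverse the orientation.
  AngleCongruent : (p q : Fin 5 → Carrier) → Set ℓ₁
  AngleCongruent p q = Σ[ f ∈ Permutation′ 5 ] ∀ k → ∃[ m ]
    MeetAt (f ⟨$⟩ʳ k) (f ⟨$⟩ʳ next k) m × p k ≈ q m

  record IsAngleCongruentTiling (π : Carrier) (angle : Assignment) : Set ℓ₁ where
    field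
      vertex-sum : ∀ c → sum (anglesAt angle (vertex c)) ≈ 2 · π
      congruent  : ∀ i j →
        AngleCongruent (λ k → angle (i , k)) (λ k → angle (j , k))

  -- The angles occurring in the tiling are exactly the values of α, β, γ, δ, ε.
  record HasAngles (angle : Assignment) (value : Name → Carrier) : Set ℓ₁ where
    field
      named  : ∀ c → ∃[ x ] angle c ≈ value x
      occurs : ∀ x → ∃[ c ] angle c ≈ value x

  Distinct : (Name → Carrier) → Set ℓ₁
  Distinct value = ∀ {x y} → x ≢ y → ¬ (value x ≈ value y)

  open Permutation setoid using (↭-setoid)
  open Permutation ↭-setoid using () renaming (_↭_ to _↭↭_)

  -- Equality of multisets of multisets of angles.
  HasVertexCombination : Assignment → List (List Carrier) → Set (c ⊔ ℓ₁)
  HasVertexCombination angle avc = List.map (anglesAt angle) vertices ↭↭ avc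

  -- { 2α³ , 6αγε , 6β²γ , 6δ²ε }
  vertexCombination : (Name → Carrier) → List (List Carrier)
  vertexCombination v =
       List.replicate 2 (v α ∷ v α ∷ v α ∷ [])
    ++ List.replicate 6 (v α ∷ v γ ∷ v ε ∷ [])
    ++ List.replicate 6 (v β ∷ v β ∷ v γ ∷ [])
    ++ List.replicate 6 (v δ ∷ v δ ∷ v ε ∷ [])

  -- Up to a symmetry of the pattern, the tiling has the angles spelled by w.
  GivenBy : Assignment → (Name → Carrier) → Words → Set ℓ₁
  GivenBy angle v w = Σ[ s ∈ Symmetry ] ∀ c →
    angle (Symmetry.corner s c) ≈ v (angleName w c)

{-# OPTIONS --safe #-}

-- Write D x for the difference of the angle named x and α.  The three angles
-- at a vertex have D-sum 0, and so do the five names together: count the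
-- corners by vertices and by tiles, and use that ordered fields are
-- torsion-free.  Linear algebra over ℤ, organised as a finite check over all
-- possible angle triples at a vertex, shows that, after renaming, the triples
-- at the vertices have sum 0 for the weights α, β, γ, δ, ε = 0, 1, -2, -1, 2.
-- All tiles carry the same cyclic word of names up to rotation and reflection,
-- so a tiling is found by a backtracking search over 10 words per tile.  The
-- search has 120 solutions, and each of them is a symmetric image of one of
-- the four tilings, possibly after swapping β with δ and γ with ε.
module Submission where

open import Defs
open import Algebra.Bundles using (CommutativeRing)
open import Data.Fin as Fin using (Fin; zero; suc)
import Data.Fin.Properties as Fin
open import Data.Fin.Permutation as Perm
  using (Permutation′; permutation; lift₀; transpose; inverseˡ; _⟨$⟩ʳ_; _⟨$⟩ˡ_; _∘ₚ_)
open import Data.Integer as ℤ using (ℤ; +_; -[1+_]; ∣_∣)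
import Data.Integer.Properties as ℤ
open import Data.Integer.Tactic.RingSolver using (solve-∀)
open import Data.List as List using (List; []; _∷_; _++_; _∷ʳ_; length)
open import Data.List.Membership.Propositional using (_∈_; lose)
open import Data.List.Membership.Propositional.Properties
  using (∈-map⁺; ∈-filter⁺; ∈-concatMap⁺; ∈-allFin; ∈-cartesianProduct⁺; ∈-cartesianProductWith⁺)
import Data.List.Membership.Setoid as Membership
import Data.List.Properties as List
import Data.List.Relation.Binary.Permutation.Setoid as Permutation
import Data.List.Relation.Binary.Permutation.Setoid.Properties as Permutationₚ
open import Data.List.Relation.Binary.Pointwise using (Pointwise; []; _∷_)
open import Data.List.Relation.Unary.All as All using (All; []; _∷_)
import Data.List.Relation.Unary.All.Properties as All
open import Data.List.Relation.Unary.Any as Any using (Any; here; there)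
open import Data.Maybe as Maybe using (Maybe; just; nothing; maybe)
import Data.Maybe.Properties as Maybe
open import Data.Nat as ℕ using (ℕ; zero; suc; _≤_; _≤?_; z≤n; s≤s)
import Data.Nat.Properties as ℕ
open import Data.Product using (Σ-syntax; ∃-syntax; _×_; _,_; proj₁; proj₂)
import Data.Product.Properties as ×
open import Data.Sum using (_⊎_; inj₁; inj₂)
open import Data.Vec as Vec using (Vec; []; _∷_; lookup; replicate; zipWith)
import Data.Vec.Properties as Vec
open import Function using (_∘_; _↔_; mk↔ₛ′; Inverse)
open import Function.Construct.Composition using (_↔-∘_)
open import Function.Construct.Identity using (↔-id)
open import Function.Construct.Symmetry using (↔-sym)
open import Relation.Binary using (DecSetoid; DecidableEquality; IsStrictPartialOrder)
open import Relation.Binary.PropositionalEquality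
  using (_≡_; _≢_; refl; sym; trans; cong; cong₂; subst; subst₂)
import Relation.Binary.PropositionalEquality.Properties as ≡
open import Relation.Nullary using (¬_; Dec; yes; no; contradiction)
open import Relation.Nullary.Decidable as Dec
  using (True; toWitness; from-yes; decidable-stable; dec⇒maybe; ¬?; _×-dec_; _⊎-dec_; _→-dec_)
open import Relation.Unary using (Decidable)

-- Exhaustive checks and decidable equality of multisets.

exhaust? : ∀ {a p} {A : Set a} {xs} → (∀ x → x ∈ xs) → {P : A → Set p} → Decidable P → Dec (∀ x → P x)
exhaust? {xs = xs} ∈xs P? =
  Dec.map′ (λ all x → All.lookup all (∈xs x)) (λ p → All.universal p xs) (All.all? P? xs)

vectors : {A : Set} → List A → ∀ n → List (Vec A n)
vectors xs 0         = [] ∷ []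
vectors xs (suc n) = List.cartesianProductWith _∷_ xs (vectors xs n)

∈-vectors : ∀ {A : Set} {xs : List A} → (∀ x → x ∈ xs) → ∀ {n} (v : Vec A n) → v ∈ vectors xs n
∈-vectors ∈xs []      = here refl
∈-vectors ∈xs (x ∷ v) = ∈-cartesianProductWith⁺ _∷_ (∈xs x) (∈-vectors ∈xs v)

sized : ∀ {A : Set} n (xs : List A) → length xs ≡ n → ∃[ v ] Vec.toList {n = n} v ≡ xs
sized _ xs refl = Vec.fromList xs , Vec.toList∘fromList xs

any₄ : ∀ {a p} {A : Set a} {P : A → Set p} {w x y z} →
  Any P (w ∷ x ∷ y ∷ z ∷ []) → P w ⊎ P x ⊎ P y ⊎ P z
any₄ (here p)                         = inj₁ p
any₄ (there (here p))                 = inj₂ (inj₁ p)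
any₄ (there (there (here p)))         = inj₂ (inj₂ (inj₁ p))
any₄ (there (there (there (here p)))) = inj₂ (inj₂ (inj₂ p))

-- The setoid is a parameter so that the module can be applied to its own result `↭-decSetoid`,
-- which decides equality of multisets of multisets.
module DecPermutation {a ℓ} (S : DecSetoid a ℓ) where
  open DecSetoid S using (Carrier; setoid)
  open Permutation setoid
  open Permutationₚ setoid
  open Membership setoid using () renaming (_∈_ to _∈ˢ_)

  ∈⇒↭-∷ : ∀ {x xs} → x ∈ˢ xs → ∃[ ys ] xs ↭ x ∷ ys
  ∈⇒↭-∷ (here {xs = xs} x≈y)  = xs , prep (DecSetoid.sym S x≈y) ↭-refl
  ∈⇒↭-∷ (there {x = y} x∈xs) with ∈⇒↭-∷ x∈xs
  ... | ys , xs↭ = y ∷ ys , ↭-trans (↭-prep y xs↭) (↭-swap y _ ↭-refl)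

  infix 4 _↭?_
  -- Greedy deletion is safe: whichever entry of `ys` equal to the head is removed, `drop-∷` shows
  -- that a permutation of the whole restricts to one of the remainders.
  _↭?_ : ∀ xs ys → Dec (xs ↭ ys)
  []       ↭? []       = yes ↭-refl
  []       ↭? (y ∷ ys) = no (¬x∷xs↭[] ∘ ↭-sym)
  (x ∷ xs) ↭? ys with Any.any? (DecSetoid._≟_ S x) ys
  ... | no  x∉ys = no λ p → x∉ys (∈-resp-↭ p (here (DecSetoid.refl S)))
  ... | yes x∈ys = Dec.map′ (λ p → ↭-trans (↭-prep x p) (↭-sym (proj₂ (∈⇒↭-∷ x∈ys))))
                            (λ p → drop-∷ (↭-trans p (proj₂ (∈⇒↭-∷ x∈ys))))
                            (xs ↭? proj₁ (∈⇒↭-∷ x∈ys))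

  ↭-decSetoid : DecSetoid _ _
  ↭-decSetoid = record
    { isDecEquivalence = record { isEquivalence = ↭-isEquivalence ; _≟_ = _↭?_ } }

-- Names and renamings

names : List Name
names = α ∷ β ∷ γ ∷ δ ∷ ε ∷ []

∈-names : ∀ x → x ∈ names
∈-names α = here refl
∈-names β = there (here refl)
∈-names γ = there (there (here refl))
∈-names δ = there (there (there (here refl)))
∈-names ε = there (there (there (there (here refl))))

toFin : Name → Fin 5
toFin α = zero
toFin β = suc zero
toFin γ = suc (suc zero)
toFin δ = suc (suc (suc zero))
toFin ε = suc (suc (suc (suc zero)))

fromFin : Fin 5 → Name
fromFin = lookup (α ∷ β ∷ γ ∷ δ ∷ ε ∷ [])

fromFin-toFin : ∀ x → fromFin (toFin x) ≡ x
fromFin-toFin α = refl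
fromFin-toFin β = refl
fromFin-toFin γ = refl
fromFin-toFin δ = refl
fromFin-toFin ε = refl

toFin-fromFin : ∀ i → toFin (fromFin i) ≡ i
toFin-fromFin zero                         = refl
toFin-fromFin (suc zero)                   = refl
toFin-fromFin (suc (suc zero))             = refl
toFin-fromFin (suc (suc (suc zero)))       = refl
toFin-fromFin (suc (suc (suc (suc zero)))) = refl

name↔fin : Name ↔ Fin 5
name↔fin = mk↔ₛ′ toFin fromFin toFin-fromFin fromFin-toFin

_≟_ : DecidableEquality Name
x ≟ y = Dec.map′
  (λ eq → trans (sym (fromFin-toFin x)) (trans (cong fromFin eq) (fromFin-toFin y)))
  (cong toFin)
  (toFin x Fin.≟ toFin y)

-- π permutes β, γ, δ, ε, numbered from 0.
renamingBy : Permutation′ 4 → Renaming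
renamingBy π = record
  { bijection = ↔-sym name↔fin ↔-∘ (lift₀ π ↔-∘ name↔fin)
  ; fixes-α   = refl
  }

-- All 24 permutations of `β`, `γ`, `δ`, `ε`, each written as a product of transpositions (0 i)(1
-- j)(2 k) with i ≥ 0, j ≥ 1, k ≥ 2.
renamings : List Renaming
renamings = List.map renamingBy
  (List.cartesianProductWith (λ i π → transpose zero i ∘ₚ π) (List.allFin 4)
  (List.cartesianProductWith (λ j π → transpose (suc zero) (suc j) ∘ₚ π) (List.allFin 3)
  (List.map (λ k → transpose (suc (suc zero)) (suc (suc k))) (List.allFin 2))))

infixr 9 _∘ᴿ_
_∘ᴿ_ : Renaming → Renaming → Renaming
r ∘ᴿ s = record
  { bijection = Renaming.bijection r ↔-∘ Renaming.bijection s
  ; fixes-α   = trans (cong (Renaming.rename r) (Renaming.fixes-α s)) (Renaming.fixes-α r)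
  }

unrename : Renaming → Name → Name
unrename r = Inverse.from (Renaming.bijection r)

rename-unrename : ∀ r x → Renaming.rename r (unrename r x) ≡ x
rename-unrename r = Inverse.strictlyInverseˡ (Renaming.bijection r)

unrename-rename : ∀ r x → unrename r (Renaming.rename r x) ≡ x
unrename-rename r = Inverse.strictlyInverseʳ (Renaming.bijection r)

Covers : List Name → Set
Covers xs = ∀ x → x ∈ xs

covers? : ∀ {n} (v : Vec Name n) → Dec (Covers (Vec.toList v))
covers? v = exhaust? ∈-names λ x → Any.any? (x ≟_) (Vec.toList v)

∈-corners : ∀ c → c ∈ corners
∈-corners (i , k) = ∈-cartesianProduct⁺ (∈-allFin i) (∈-allFin k)

-- Linear forms with integer coefficients

Form : ℕ → Set
Form = Vec ℤ

infixl 6 _⊕_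
infixl 7 _⊙_

_⊕_ : ∀ {m} → Form m → Form m → Form m
_⊕_ = zipWith ℤ._+_

_⊙_ : ∀ {m} → ℤ → Form m → Form m
k ⊙ f = Vec.map (k ℤ.*_) f

unit : ∀ {m} → Fin m → Form m
unit zero    = + 1 ∷ replicate _ (+ 0)
unit (suc i) = + 0 ∷ unit i

-- `f` is nonzero and `g` is a rational multiple of it, possibly 0. Cross-multiplication keeps the
-- condition inside ℤ, where it is decidable.
Parallel : ∀ {m} → Form m → Form m → Set
Parallel f g = ∃[ i ] lookup f i ≢ + 0 × lookup f i ⊙ g ≡ lookup g i ⊙ f

parallel? : ∀ {m} (f g : Form m) → Dec (Parallel f g)
parallel? f g = Fin.any? λ i →
  ¬? (lookup f i ℤ.≟ + 0) ×-dec Vec.≡-dec ℤ._≟_ (lookup f i ⊙ g) (lookup g i ⊙ f)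

-- Integer multiples and values of linear forms in an ordered field.

module IntegerMultiples {c ℓ₁ ℓ₂ ℓ₃} (F : OrderedField c ℓ₁ ℓ₂ ℓ₃) where
  open OrderedField F using (_<_; tight; #⇒<⊎>; +-monoˡ-<; isStrictPartialOrder; commutativeRing)
  open IsStrictPartialOrder isStrictPartialOrder using (<-respʳ-≈; <-respˡ-≈)
    renaming (trans to <-trans; irrefl to <-irrefl)
  open CommutativeRing commutativeRing hiding (zero)
    renaming (refl to ≈-refl; sym to ≈-sym; trans to ≈-trans; reflexive to ≈-reflexive)
  open import Algebra.Properties.CommutativeMonoid.Mult +-commutativeMonoid
    renaming (_×_ to _·_)
  open import Algebra.Properties.AbelianGroup +-abelianGroup
    using (⁻¹-∙-comm; ε⁻¹≈ε; ⁻¹-involutive)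
  open import Algebra.Properties.CommutativeSemigroup +-commutativeSemigroup
    using (interchange)
  open import Relation.Binary.Reasoning.Setoid setoid

  infixr 7 _⊛_
  _⊛_ : ℤ → Carrier → Carrier
  (+ n)    ⊛ x = n · x
  -[1+ n ] ⊛ x = - (suc n · x)

  ⊛-congʳ : ∀ k {x y} → x ≈ y → k ⊛ x ≈ k ⊛ y
  ⊛-congʳ (+ n)    x≈y = ×-congʳ n x≈y
  ⊛-congʳ -[1+ n ] x≈y = -‿cong (×-congʳ (suc n) x≈y)

  ⊖-⊛ : ∀ m n x → (m ℤ.⊖ n) ⊛ x ≈ m · x - n · x
  ⊖-⊛ zero    zero    x = ≈-sym (-‿inverseʳ 0#)
  ⊖-⊛ zero    (suc n) x = ≈-sym (+-identityˡ _)
  ⊖-⊛ (suc m) zero    x = ≈-sym (≈-trans (+-congˡ ε⁻¹≈ε) (+-identityʳ _))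
  ⊖-⊛ (suc m) (suc n) x = begin
    (suc m ℤ.⊖ suc n) ⊛ x               ≡⟨ cong (_⊛ x) (ℤ.[1+m]⊖[1+n]≡m⊖n m n) ⟩
    (m ℤ.⊖ n) ⊛ x                       ≈⟨ ⊖-⊛ m n x ⟩
    m · x - n · x                       ≈⟨ +-identityˡ _ ⟨
    0# + (m · x - n · x)                ≈⟨ +-congʳ (-‿inverseʳ x) ⟨
    (x - x) + (m · x - n · x)           ≈⟨ interchange x (- x) (m · x) (- (n · x)) ⟩
    (x + m · x) + (- x + - (n · x))     ≈⟨ +-congˡ (⁻¹-∙-comm x (n · x)) ⟩
    (x + m · x) - (x + n · x)           ∎

  ⊛-homo-+ : ∀ j k x → (j ℤ.+ k) ⊛ x ≈ j ⊛ x + k ⊛ x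
  ⊛-homo-+ (+ m)    (+ n)    x = ×-homo-+ x m n
  ⊛-homo-+ (+ m)    -[1+ n ] x = ⊖-⊛ m (suc n) x
  ⊛-homo-+ -[1+ m ] (+ n)    x = ≈-trans (⊖-⊛ n (suc m) x) (+-comm _ _)
  ⊛-homo-+ -[1+ m ] -[1+ n ] x = begin
    - (suc (suc (m ℕ.+ n)) · x)        ≡⟨ cong (λ l → - (suc l · x)) (sym (ℕ.+-suc m n)) ⟩
    - ((suc m ℕ.+ suc n) · x)          ≈⟨ -‿cong (×-homo-+ x (suc m) (suc n)) ⟩
    - (suc m · x + suc n · x)          ≈⟨ ⁻¹-∙-comm _ _ ⟨
    - (suc m · x) + - (suc n · x)      ∎

  ⊛-distrib-+ : ∀ k x y → k ⊛ (x + y) ≈ k ⊛ x + k ⊛ y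
  ⊛-distrib-+ (+ n)    x y = ×-distrib-+ x y n
  ⊛-distrib-+ -[1+ n ] x y = ≈-trans (-‿cong (×-distrib-+ x y (suc n))) (≈-sym (⁻¹-∙-comm _ _))

  ·-zeroʳ : ∀ n → n · 0# ≈ 0#
  ·-zeroʳ zero    = ≈-refl
  ·-zeroʳ (suc n) = ≈-trans (+-identityˡ _) (·-zeroʳ n)

  ⊛-zeroʳ : ∀ k → k ⊛ 0# ≈ 0#
  ⊛-zeroʳ (+ n)    = ·-zeroʳ n
  ⊛-zeroʳ -[1+ n ] = ≈-trans (-‿cong (·-zeroʳ (suc n))) ε⁻¹≈ε

  neg-⊛ : ∀ k x → (ℤ.- k) ⊛ x ≈ - (k ⊛ x)
  neg-⊛ (+ zero)  x = ≈-sym ε⁻¹≈ε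
  neg-⊛ (+ suc n) x = ≈-refl
  neg-⊛ -[1+ n ]  x = ≈-sym (⁻¹-involutive _)

  ⊛-assoc-ℕ : ∀ n k x → (+ n ℤ.* k) ⊛ x ≈ n · (k ⊛ x)
  ⊛-assoc-ℕ zero    k x = ≈-reflexive (cong (_⊛ x) (ℤ.*-zeroˡ k))
  ⊛-assoc-ℕ (suc n) k x = begin
    (+ suc n ℤ.* k) ⊛ x          ≡⟨ cong (_⊛ x) (ℤ.suc-* (+ n) k) ⟩
    (k ℤ.+ + n ℤ.* k) ⊛ x        ≈⟨ ⊛-homo-+ k (+ n ℤ.* k) x ⟩
    k ⊛ x + (+ n ℤ.* k) ⊛ x      ≈⟨ +-congˡ (⊛-assoc-ℕ n k x) ⟩
    k ⊛ x + n · (k ⊛ x)          ∎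

  ⊛-assoc : ∀ j k x → (j ℤ.* k) ⊛ x ≈ j ⊛ (k ⊛ x)
  ⊛-assoc (+ n)    k x = ⊛-assoc-ℕ n k x
  ⊛-assoc -[1+ n ] k x = begin
    (-[1+ n ] ℤ.* k) ⊛ x          ≡⟨ cong (_⊛ x) (sym (ℤ.neg-distribˡ-* (+ suc n) k)) ⟩
    (ℤ.- (+ suc n ℤ.* k)) ⊛ x     ≈⟨ neg-⊛ (+ suc n ℤ.* k) x ⟩
    - ((+ suc n ℤ.* k) ⊛ x)       ≈⟨ -‿cong (⊛-assoc-ℕ (suc n) k x) ⟩
    - (suc n · (k ⊛ x))           ∎

  positive-multiple : ∀ n {x} → 0# < x → 0# < suc n · x
  positive-multiple zero    0<x = <-respʳ-≈ (≈-sym (+-identityʳ _)) 0<x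
  positive-multiple (suc n) 0<x = <-trans 0<x
    (<-respʳ-≈ (+-comm _ _) (<-respˡ-≈ (+-identityˡ _) (+-monoˡ-< _ (positive-multiple n 0<x))))

  negative-multiple : ∀ n {x} → x < 0# → suc n · x < 0#
  negative-multiple zero    x<0 = <-respˡ-≈ (≈-sym (+-identityʳ _)) x<0
  negative-multiple (suc n) x<0 = <-trans
    (<-respʳ-≈ (+-identityˡ _) (<-respˡ-≈ (+-comm _ _) (+-monoˡ-< _ (negative-multiple n x<0)))) x<0

  -- By tightness it suffices to refute `x # 0#`. Apartness from 0 would give `x` a sign, which
  -- every positive multiple keeps.
  ·-torsion-free : ∀ n {x} → suc n · x ≈ 0# → x ≈ 0#
  ·-torsion-free n {x} nx≈0 = proj₁ (tight x 0#) λ x#0 → helper (#⇒<⊎> x#0)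
    where
    helper : ¬ _
    helper (inj₁ x<0) = <-irrefl nx≈0 (negative-multiple n x<0)
    helper (inj₂ 0<x) = <-irrefl (≈-sym nx≈0) (positive-multiple n 0<x)

  ⊛-torsion-free : ∀ k {x} → k ≢ + 0 → k ⊛ x ≈ 0# → x ≈ 0#
  ⊛-torsion-free (+ zero)  k≢0 _    = contradiction refl k≢0
  ⊛-torsion-free (+ suc n) _   kx≈0 = ·-torsion-free n kx≈0
  ⊛-torsion-free -[1+ n ]  _   kx≈0 =
    ·-torsion-free n (≈-trans (≈-sym (⁻¹-involutive _)) (≈-trans (-‿cong kx≈0) ε⁻¹≈ε))

  infix 8 ⟦_⟧_
  ⟦_⟧_ : ∀ {m} → Form m → Vec Carrier m → Carrier
  ⟦ [] ⟧    []      = 0#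
  ⟦ k ∷ f ⟧ (x ∷ b) = k ⊛ x + ⟦ f ⟧ b

  ⟦0⟧ : ∀ {m} (b : Vec Carrier m) → ⟦ replicate m (+ 0) ⟧ b ≈ 0#
  ⟦0⟧ []      = ≈-refl
  ⟦0⟧ (x ∷ b) = ≈-trans (+-identityˡ _) (⟦0⟧ b)

  ⟦unit⟧ : ∀ {m} i (b : Vec Carrier m) → ⟦ unit i ⟧ b ≈ lookup b i
  ⟦unit⟧ zero    (x ∷ b) = ≈-trans (+-cong (+-identityʳ x) (⟦0⟧ b)) (+-identityʳ x)
  ⟦unit⟧ (suc i) (x ∷ b) = ≈-trans (+-identityˡ _) (⟦unit⟧ i b)

  ⟦⊕⟧ : ∀ {m} f g (b : Vec Carrier m) → ⟦ f ⊕ g ⟧ b ≈ ⟦ f ⟧ b + ⟦ g ⟧ b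
  ⟦⊕⟧ []      []      []      = ≈-sym (+-identityˡ 0#)
  ⟦⊕⟧ (j ∷ f) (k ∷ g) (x ∷ b) =
    ≈-trans (+-cong (⊛-homo-+ j k x) (⟦⊕⟧ f g b)) (interchange _ _ _ _)

  ⟦⊙⟧ : ∀ {m} k f (b : Vec Carrier m) → ⟦ k ⊙ f ⟧ b ≈ k ⊛ ⟦ f ⟧ b
  ⟦⊙⟧ k []      []      = ≈-sym (⊛-zeroʳ k)
  ⟦⊙⟧ k (j ∷ f) (x ∷ b) =
    ≈-trans (+-cong (⊛-assoc k j x) (⟦⊙⟧ k f b)) (≈-sym (⊛-distrib-+ k _ _))

  ⟦⊙⟧≈0 : ∀ {m} k f (b : Vec Carrier m) → ⟦ f ⟧ b ≈ 0# → ⟦ k ⊙ f ⟧ b ≈ 0#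
  ⟦⊙⟧≈0 k f b f≈0 = ≈-trans (⟦⊙⟧ k f b) (≈-trans (⊛-congʳ k f≈0) (⊛-zeroʳ k))

  -- The multiple of `g` by the nonzero coefficient of `f` is also a multiple of `f`, so it
  -- vanishes, and torsion-freeness cancels the coefficient.
  parallel≈0 : ∀ {m} {f g} {b : Vec Carrier m} → Parallel f g → ⟦ f ⟧ b ≈ 0# → ⟦ g ⟧ b ≈ 0#
  parallel≈0 {f = f} {g} {b} (i , fᵢ≢0 , fᵢg≡gᵢf) f≈0 = ⊛-torsion-free (lookup f i) fᵢ≢0 (begin
    lookup f i ⊛ ⟦ g ⟧ b    ≈⟨ ⟦⊙⟧ (lookup f i) g b ⟨
    ⟦ lookup f i ⊙ g ⟧ b    ≡⟨ cong (λ h → ⟦ h ⟧ b) fᵢg≡gᵢf ⟩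
    ⟦ lookup g i ⊙ f ⟧ b    ≈⟨ ⟦⊙⟧≈0 (lookup g i) f b f≈0 ⟩
    0#                      ∎)

-- Relations forced by the angles at one or two vertices

Triple : Set
Triple = Vec Name 3

triples : List Triple
triples = vectors names 3

∀ᵀ? : ∀ {p} {P : Triple → Set p} → Decidable P → Dec (∀ t → P t)
∀ᵀ? = exhaust? {xs = triples} (∈-vectors ∈-names)

Coordinates : Set
Coordinates = Name → Form 4

pattern −1ℤ = -[1+ 0 ]
pattern −2ℤ = -[1+ 1 ]

weight : Name → ℤ
weight α = + 0
weight β = + 1
weight γ = −2ℤ
weight δ = −1ℤ
weight ε = + 2

-- Coordinates of D with respect to D β, D γ, D δ, D ε, rewritten modulo
-- D β + D γ + D δ + D ε = 0 (free), modulo this and 2 D β + D γ = 0 (chained),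
-- modulo it and D β + D δ = 0 (balanced), modulo all three (weighted).
independent free chained balanced weighted : Coordinates
independent α = + 0 ∷ + 0 ∷ + 0 ∷ + 0 ∷ []
independent β = + 1 ∷ + 0 ∷ + 0 ∷ + 0 ∷ []
independent γ = + 0 ∷ + 1 ∷ + 0 ∷ + 0 ∷ []
independent δ = + 0 ∷ + 0 ∷ + 1 ∷ + 0 ∷ []
independent ε = + 0 ∷ + 0 ∷ + 0 ∷ + 1 ∷ []

free ε = −1ℤ ∷ −1ℤ ∷ −1ℤ ∷ + 0 ∷ []
free x = independent x

chained γ = −2ℤ ∷ + 0 ∷ + 0 ∷ + 0 ∷ []
chained ε = + 1 ∷ + 0 ∷ −1ℤ ∷ + 0 ∷ []
chained x = independent x

balanced δ = −1ℤ ∷ + 0 ∷ + 0 ∷ + 0 ∷ []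
balanced ε = + 0 ∷ −1ℤ ∷ + 0 ∷ + 0 ∷ []
balanced x = independent x

weighted x = weight x ∷ + 0 ∷ + 0 ∷ + 0 ∷ []

total : Coordinates → List Name → Form 4
total c = List.foldr (λ x f → c x ⊕ f) (replicate _ (+ 0))

-- The vanishing of f makes two of the five angles equal.
Collision : Coordinates → Form 4 → Set
Collision c f = Any (λ x → Any (λ y → x ≢ y × Parallel f (c x ⊕ −1ℤ ⊙ c y)) names) names

collision? : ∀ c f → Dec (Collision c f)
collision? c f = Any.any?
  (λ x → Any.any? (λ y → ¬? (x ≟ y) ×-dec parallel? f (c x ⊕ −1ℤ ⊙ c y)) names) names

-- As D `α` = 0, the two vertices say D `δ` = - D `β` and D `γ` = -2 D `β`. With the sum of all five
-- they fix the weights up to a common factor.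
αβδ ββγ : List Name
αβδ = α ∷ β ∷ δ ∷ []
ββγ = β ∷ β ∷ γ ∷ []

opposite double : Renaming → List Name
opposite r = List.map (Renaming.rename r) αβδ
double   r = List.map (Renaming.rename r) ββγ

weightSum : List Name → ℤ
weightSum = List.foldr (λ x k → weight x ℤ.+ k) (+ 0)

ForcesWeights : Triple → Set
ForcesWeights t = weightSum (Vec.toList t) ≡ + 0 ⊎ Collision weighted (total weighted (Vec.toList t))

forcesWeights? : ∀ t → Dec (ForcesWeights t)
forcesWeights? t =
  (weightSum (Vec.toList t) ℤ.≟ + 0) ⊎-dec collision? weighted (total weighted (Vec.toList t))

abstract
  -- In weighted coordinates the vertex says s D `β` = 0, where s is its weight sum. If s ≠ 0, every
  -- D vanishes and the angles coincide.
  forces-weights : ∀ t → ForcesWeights t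
  forces-weights = from-yes (∀ᵀ? forcesWeights?)

ForcesOpposite : Coordinates → Form 4 → Set
ForcesOpposite c f = Collision c f ⊎ Any (λ r → Parallel f (total c (opposite r))) renamings

forcesOpposite? : ∀ c f → Dec (ForcesOpposite c f)
forcesOpposite? c f = collision? c f ⊎-dec Any.any? (λ r → parallel? f (total c (opposite r))) renamings

ForcesOppositeOrDouble : Form 4 → Set
ForcesOppositeOrDouble f =
  ForcesOpposite free f ⊎ Any (λ r → Parallel f (total free (double r))) renamings

forcesOppositeOrDouble? : ∀ f → Dec (ForcesOppositeOrDouble f)
forcesOppositeOrDouble? f =
  forcesOpposite? free f ⊎-dec Any.any? (λ r → parallel? f (total free (double r))) renamings

abstract
  -- A relation D `β` + D x + D y = 0 with `β`, x, y distinct and different from `α` would make the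
  -- D of the fourth name 0. The other triples with `β` give D x + D y = 0 or 2 D x + D y = 0 for
  -- two names, or a single vanishing D.
  forces-opposite-or-double :
    ∀ (t : Triple) → β ∈ Vec.toList t → ForcesOppositeOrDouble (total free (Vec.toList t))
  forces-opposite-or-double = from-yes (∀ᵀ?
    (λ t → Any.any? (β ≟_) (Vec.toList t) →-dec forcesOppositeOrDouble? (total free (Vec.toList t))))

ForcesModel : Form 4 → Set
ForcesModel f = Collision balanced f
  ⊎ Any (λ r → Parallel f (total balanced (opposite r)) ×
               Parallel f (total balanced (double r))) renamings

forcesModel? : ∀ f → Dec (ForcesModel f)
forcesModel? f = collision? balanced f ⊎-dec
  Any.any? (λ r → parallel? f (total balanced (opposite r)) ×-dec
                  parallel? f (total balanced (double r))) renamings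

abstract
  -- In balanced coordinates the relation is p D `β` + q D `γ` = 0 with |p| + |q| ≤ 3. It is a
  -- collision if p or q is 0 or |p| = |q|; the pair p = q = 0 has weight sum 0. Otherwise one of
  -- |p|, |q| is twice the other, which is the weighted model up to a renaming.
  forces-model :
    ∀ (t : Triple) → weightSum (Vec.toList t) ≢ + 0 → ForcesModel (total balanced (Vec.toList t))
  forces-model = from-yes (∀ᵀ?
    (λ t → ¬? (weightSum (Vec.toList t) ℤ.≟ + 0) →-dec forcesModel? (total balanced (Vec.toList t))))

-- Cancels the coordinate of D β.
eliminate : Form 4 → Form 4 → Form 4
eliminate f g = lookup f zero ⊙ g ⊕ (ℤ.- lookup g zero) ⊙ f

TogetherForceOpposite : Form 4 → Form 4 → Set
TogetherForceOpposite f g = ForcesOpposite chained g ⊎ Collision chained (eliminate f g)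

ForcesOppositeWithε : Form 4 → Set
ForcesOppositeWithε f = ForcesOpposite chained f ⊎
  (∀ (t : Triple) → ε ∈ Vec.toList t → TogetherForceOpposite f (total chained (Vec.toList t)))

forcesOppositeWithε? : ∀ f → Dec (ForcesOppositeWithε f)
forcesOppositeWithε? f = forcesOpposite? chained f ⊎-dec
  ∀ᵀ? (λ t → Any.any? (ε ≟_) (Vec.toList t) →-dec together? (total chained (Vec.toList t)))
  where
  together? : ∀ g → Dec (TogetherForceOpposite f g)
  together? g = forcesOpposite? chained g ⊎-dec collision? chained (eliminate f g)

abstract
  -- Given D `γ` = -2 D `β`, the only relations at a vertex with `δ` that give neither a collision
  -- nor an opposite pair are 2 D `δ` + D `β` = 0 and 2 D `γ` + D `δ` = 0. They make D `β`, D `γ`, D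
  -- `δ`, D `ε` proportional to -2, 4, 1, -3 or to 1, -2, 4, -3. No triple from 0, 1, -2, 4, -3 that
  -- contains -3 has sum 0, so a vertex with `ε` gives a second, independent relation and hence a
  -- collision.
  double-forces-opposite :
    ∀ (t : Triple) → δ ∈ Vec.toList t → ForcesOppositeWithε (total chained (Vec.toList t))
  double-forces-opposite = from-yes (∀ᵀ?
    (λ t → Any.any? (δ ≟_) (Vec.toList t) →-dec forcesOppositeWithε? (total chained (Vec.toList t))))

relabel : Renaming → (Corner → Triple) → Corner → Triple
relabel r T c = Vec.map (unrename r) (T c)

Weightable : (Corner → Triple) → Set
Weightable T = ∃[ r ] ∀ c → weightSum (Vec.toList (relabel r T c)) ≡ + 0

relabel-weightable : ∀ T r → Weightable (relabel r T) → Weightable T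
relabel-weightable T r (s , zero-sum) = r ∘ᴿ s , λ c →
  trans (cong (weightSum ∘ Vec.toList) (Vec.map-∘ (unrename s) (unrename r) (T c))) (zero-sum c)

-- Deriving the weights from the relations between the actual angles.

module Relations {c ℓ₁ ℓ₂ ℓ₃} (F : OrderedField c ℓ₁ ℓ₂ ℓ₃) where
  open IntegerMultiples F
  open Angles F using (sum; Distinct)
  open OrderedField F using (commutativeRing)
  open CommutativeRing commutativeRing hiding (zero)
    renaming (refl to ≈-refl; sym to ≈-sym; trans to ≈-trans; reflexive to ≈-reflexive)
  open import Algebra.Properties.AbelianGroup +-abelianGroup using (∙-cancelʳ)
  open import Relation.Binary.Reasoning.Setoid setoid

  deviation : (Name → Carrier) → Name → Carrier
  deviation value x = value x - value α

  deviationSum : (Name → Carrier) → List Name → Carrier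
  deviationSum value xs = sum (List.map (deviation value) xs)

  -- `pentagon` ranges over all lists that exhaust the names, and not over `names` alone, so that
  -- the record is visibly stable under renaming.
  record Consistent (value : Name → Carrier) (T : Corner → Triple) : Set ℓ₁ where
    field
      distinct   : Distinct value
      pentagon   : ∀ xs → length xs ≡ 5 → Covers xs → deviationSum value xs ≈ 0#
      vertex-sum : ∀ c → deviationSum value (Vec.toList (T c)) ≈ 0#
      occurs     : ∀ x → ∃[ c ] x ∈ Vec.toList (T c)

  deviation-rename : ∀ value r x →
    deviation (value ∘ Renaming.rename r) x ≡ deviation value (Renaming.rename r x)
  deviation-rename value r x = cong (λ y → value (Renaming.rename r x) - value y) (Renaming.fixes-α r)

  deviationSum-rename : ∀ value r xs →
    deviationSum (value ∘ Renaming.rename r) xs ≡ deviationSum value (List.map (Renaming.rename r) xs)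
  deviationSum-rename value r xs = cong sum
    (trans (List.map-cong (deviation-rename value r) xs) (List.map-∘ xs))

  -- Values are read through `r` and triples through its inverse, so the angles themselves do not
  -- change. A relation found up to renaming may thus be taken to be `αβδ` or `ββγ` itself.
  relabel-consistent : ∀ {value T} r → Consistent value T →
    Consistent (value ∘ Renaming.rename r) (relabel r T)
  relabel-consistent {value} {T} r S = record
    { distinct   = λ {x} {y} x≢y → distinct λ eq → x≢y
        (trans (sym (unrename-rename r x)) (trans (cong (unrename r) eq) (unrename-rename r y)))
    ; pentagon   = λ xs len covers → ≈-trans (≈-reflexive (deviationSum-rename value r xs))
        (pentagon _ (trans (List.length-map _ xs) len)
          λ x → subst (_∈ _) (rename-unrename r x) (∈-map⁺ _ (covers (unrename r x))))
    ; vertex-sum = λ c → ≈-trans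
        (≈-reflexive (deviationSum-rename value r (Vec.toList (Vec.map (unrename r) (T c)))))
        (≈-trans (≈-reflexive (cong (deviationSum value) (rename-relabel (T c)))) (vertex-sum c))
    ; occurs     = λ x → let c , x∈T = occurs (Renaming.rename r x) in
        c , subst₂ _∈_ (unrename-rename r x) (sym (Vec.toList-map (unrename r) (T c)))
              (∈-map⁺ (unrename r) x∈T)
    }
    where
    open Consistent S
    rename-relabel : ∀ {n} (v : Vec Name n) →
      List.map (Renaming.rename r) (Vec.toList (Vec.map (unrename r) v)) ≡ Vec.toList v
    rename-relabel []      = refl
    rename-relabel (x ∷ v) = cong₂ _∷_ (rename-unrename r x) (rename-relabel v)

  module _ {value : Name → Carrier} {T : Corner → Triple} (S : Consistent value T) where
    open Consistent S

    basis : Vec Carrier 4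
    basis = Vec.map (deviation value) (β ∷ γ ∷ δ ∷ ε ∷ [])

    Realises : Coordinates → Set ℓ₁
    Realises c = ∀ x → ⟦ c x ⟧ basis ≈ deviation value x

    ⟦total⟧ : ∀ c → Realises c → ∀ xs → ⟦ total c xs ⟧ basis ≈ deviationSum value xs
    ⟦total⟧ c c-real []       = ⟦0⟧ basis
    ⟦total⟧ c c-real (x ∷ xs) =
      ≈-trans (⟦⊕⟧ (c x) (total c xs) basis) (+-cong (c-real x) (⟦total⟧ c c-real xs))

    ⟦total⟧≈0 : ∀ c xs → Realises c → deviationSum value xs ≈ 0# → ⟦ total c xs ⟧ basis ≈ 0#
    ⟦total⟧≈0 c xs c-real xs≈0 = ≈-trans (⟦total⟧ c c-real xs) xs≈0

    -- A form that vanishes on the basis may be added to any coordinates with any multiplicity, so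
    -- each known relation serves to eliminate one basis element.
    reduce : ∀ c xs (k : Name → ℤ) → Realises c → deviationSum value xs ≈ 0# →
      Realises (λ x → c x ⊕ k x ⊙ total c xs)
    reduce c xs k c-real xs≈0 x = begin
      ⟦ c x ⊕ k x ⊙ total c xs ⟧ basis              ≈⟨ ⟦⊕⟧ (c x) (k x ⊙ total c xs) basis ⟩
      ⟦ c x ⟧ basis + ⟦ k x ⊙ total c xs ⟧ basis    ≈⟨ +-cong (c-real x) kt≈0 ⟩
      deviation value x + 0#                        ≈⟨ +-identityʳ _ ⟩
      deviation value x                             ∎
      where
      kt≈0 = ⟦⊙⟧≈0 (k x) (total c xs) basis (⟦total⟧≈0 c xs c-real xs≈0)

    independent-realises : Realises independent
    independent-realises α = ≈-trans (⟦0⟧ basis) (≈-sym (-‿inverseʳ (value α)))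
    independent-realises β = ⟦unit⟧ zero basis
    independent-realises γ = ⟦unit⟧ (suc zero) basis
    independent-realises δ = ⟦unit⟧ (suc (suc zero)) basis
    independent-realises ε = ⟦unit⟧ (suc (suc (suc zero))) basis

    free-realises : Realises free
    -- `free` has a catch-all clause and reduces only on constructors; the case split lets each
    -- instance of `real` compute to the required type.
    free-realises = λ { α → real α ; β → real β ; γ → real γ ; δ → real δ ; ε → real ε }
      where
      real = reduce independent names (λ { ε → −1ℤ ; _ → + 0 })
        independent-realises (pentagon names refl ∈-names)

    chained-realises : deviationSum value ββγ ≈ 0# → Realises chained
    chained-realises ββγ≈0 = λ { α → real α ; β → real β ; γ → real γ ; δ → real δ ; ε → real ε }
      where
      -- `total free ββγ` is 2 D `β` + D `γ`; the multipliers clear the D `γ` coordinate of `γ` and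
      -- of `ε`.
      real = reduce free ββγ (λ { γ → −1ℤ ; ε → + 1 ; _ → + 0 }) free-realises ββγ≈0

    balanced-realises : deviationSum value αβδ ≈ 0# → Realises balanced
    balanced-realises αβδ≈0 = λ { α → real α ; β → real β ; γ → real γ ; δ → real δ ; ε → real ε }
      where
      real = reduce free αβδ (λ { δ → −1ℤ ; ε → + 1 ; _ → + 0 }) free-realises αβδ≈0

    weighted-realises : deviationSum value αβδ ≈ 0# → deviationSum value ββγ ≈ 0# →
      Realises weighted
    weighted-realises αβδ≈0 ββγ≈0 = λ { α → real α ; β → real β ; γ → real γ ; δ → real δ ; ε → real ε }
      where
      real = reduce balanced ββγ (λ { γ → −1ℤ ; ε → + 1 ; _ → + 0 })
        (balanced-realises αβδ≈0) ββγ≈0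

    no-collision : ∀ c f → Realises c → ⟦ f ⟧ basis ≈ 0# → ¬ Collision c f
    no-collision c f c-real f≈0 collision =
      let x , y∈ = Any.satisfied collision
          y , x≢y , f∥x-y = Any.satisfied y∈
      in distinct x≢y (∙-cancelʳ (- value α) _ _ (begin
        deviation value x
          ≈⟨ +-identityʳ _ ⟨
        deviation value x + 0#
          ≈⟨ +-congˡ (-‿inverseˡ _) ⟨
        deviation value x + (- deviation value y + deviation value y)
          ≈⟨ +-assoc _ _ _ ⟨
        (deviation value x - deviation value y) + deviation value y
          ≈⟨ +-congʳ (+-cong (c-real x) (-‿cong (≈-trans (+-identityʳ _) (c-real y)))) ⟨
        (⟦ c x ⟧ basis + −1ℤ ⊛ ⟦ c y ⟧ basis) + deviation value y
          ≈⟨ +-congʳ (+-congˡ (⟦⊙⟧ −1ℤ (c y) basis)) ⟨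
        (⟦ c x ⟧ basis + ⟦ −1ℤ ⊙ c y ⟧ basis) + deviation value y
          ≈⟨ +-congʳ (⟦⊕⟧ (c x) (−1ℤ ⊙ c y) basis) ⟨
        ⟦ c x ⊕ −1ℤ ⊙ c y ⟧ basis + deviation value y
          ≈⟨ +-congʳ (parallel≈0 {f = f} f∥x-y f≈0) ⟩
        0# + deviation value y
          ≈⟨ +-identityˡ _ ⟩
        deviation value y  ∎))

    HasOpposite : Set ℓ₁
    HasOpposite = ∃[ r ] deviationSum value (opposite r) ≈ 0#

    parallel-sum≈0 : ∀ c f xs → Realises c → ⟦ f ⟧ basis ≈ 0# → Parallel f (total c xs) →
      deviationSum value xs ≈ 0#
    parallel-sum≈0 c f xs c-real f≈0 f∥xs =
      ≈-trans (≈-sym (⟦total⟧ c c-real xs)) (parallel≈0 {f = f} f∥xs f≈0)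

    forced-opposite : ∀ c f → Realises c → ⟦ f ⟧ basis ≈ 0# → ForcesOpposite c f → HasOpposite
    forced-opposite c f c-real f≈0 (inj₁ collision) =
      contradiction collision (no-collision c f c-real f≈0)
    forced-opposite c f c-real f≈0 (inj₂ ∥opposite) = let r , f∥opposite = Any.satisfied ∥opposite in
      r , parallel-sum≈0 c f (opposite r) c-real f≈0 f∥opposite

    model⇒zero-sum : deviationSum value αβδ ≈ 0# → deviationSum value ββγ ≈ 0# →
      ∀ c → weightSum (Vec.toList (T c)) ≡ + 0
    model⇒zero-sum αβδ≈0 ββγ≈0 c = cases (forces-weights (T c))
      where
      f = total weighted (Vec.toList (T c))
      real = weighted-realises αβδ≈0 ββγ≈0
      cases : ForcesWeights (T c) → weightSum (Vec.toList (T c)) ≡ + 0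
      cases (inj₁ zero-sum)  = zero-sum
      cases (inj₂ collision) = contradiction collision
        (no-collision weighted f real (⟦total⟧≈0 weighted (Vec.toList (T c)) real (vertex-sum c)))

    eliminate≈0 : ∀ f g → ⟦ f ⟧ basis ≈ 0# → ⟦ g ⟧ basis ≈ 0# → ⟦ eliminate f g ⟧ basis ≈ 0#
    eliminate≈0 f g f≈0 g≈0 = ≈-trans (⟦⊕⟧ (j ⊙ g) ((ℤ.- k) ⊙ f) basis)
      (≈-trans (+-cong (⟦⊙⟧≈0 j g basis g≈0) (⟦⊙⟧≈0 (ℤ.- k) f basis f≈0)) (+-identityʳ 0#))
      where
      j = lookup f zero
      k = lookup g zero

    double⇒opposite : deviationSum value ββγ ≈ 0# → HasOpposite
    double⇒opposite ββγ≈0 = cases (double-forces-opposite (T p) δ∈)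
      where
      p = proj₁ (occurs δ)
      q = proj₁ (occurs ε)
      δ∈ = proj₂ (occurs δ)
      ε∈ = proj₂ (occurs ε)
      real = chained-realises ββγ≈0
      f = total chained (Vec.toList (T p))
      g = total chained (Vec.toList (T q))
      f≈0 = ⟦total⟧≈0 chained (Vec.toList (T p)) real (vertex-sum p)
      g≈0 = ⟦total⟧≈0 chained (Vec.toList (T q)) real (vertex-sum q)
      cases′ : TogetherForceOpposite f g → HasOpposite
      cases′ (inj₁ forced)    = forced-opposite chained g real g≈0 forced
      cases′ (inj₂ collision) =
        contradiction collision (no-collision chained (eliminate f g) real (eliminate≈0 f g f≈0 g≈0))
      cases : ForcesOppositeWithε f → HasOpposite
      cases (inj₁ forced) = forced-opposite chained f real f≈0 forced
      cases (inj₂ forced) = cases′ (forced (T q) ε∈)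

  rename≈0 : ∀ value r xs → deviationSum value (List.map (Renaming.rename r) xs) ≈ 0# →
    deviationSum (value ∘ Renaming.rename r) xs ≈ 0#
  rename≈0 value r xs = ≈-trans (≈-reflexive (deviationSum-rename value r xs))

  -- Either every vertex already has weight 0 and the identity works, or a vertex of nonzero weight
  -- forces the weighted model after a renaming, and then all vertices have weight 0 for that
  -- renaming.
  opposite⇒weightable : ∀ {value T} → Consistent value T →
    deviationSum value αβδ ≈ 0# → Weightable T
  opposite⇒weightable {value} {T} S αβδ≈0 =
    cases (Any.any? (λ c → ¬? (weightSum (Vec.toList (T c)) ℤ.≟ + 0)) corners)
    where
    real = balanced-realises S αβδ≈0
    forced : ∀ f → ⟦ f ⟧ basis S ≈ 0# → ForcesModel f → Weightable T
    forced f f≈0 (inj₁ collision) = contradiction collision (no-collision S balanced f real f≈0)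
    forced f f≈0 (inj₂ ∥model) = let r , ∥opposite , ∥double = Any.satisfied ∥model in
      r , model⇒zero-sum (relabel-consistent r S)
        (rename≈0 value r αβδ (parallel-sum≈0 S balanced f (opposite r) real f≈0 ∥opposite))
        (rename≈0 value r ββγ (parallel-sum≈0 S balanced f (double r) real f≈0 ∥double))
    cases : Dec (Any (λ c → weightSum (Vec.toList (T c)) ≢ + 0) corners) → Weightable T
    cases (no none) = record { bijection = ↔-id Name ; fixes-α = refl } , λ c →
      trans (cong (weightSum ∘ Vec.toList) (Vec.map-id (T c)))
        (decidable-stable (_ ℤ.≟ _) λ nonzero → none (lose (∈-corners c) nonzero))
    cases (yes some) = let c , nonzero = Any.satisfied some in
      forced _ (⟦total⟧≈0 S balanced (Vec.toList (T c)) real (Consistent.vertex-sum S c))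
        (forces-model (T c) nonzero)

  hasOpposite⇒weightable : ∀ {value T} (S : Consistent value T) → HasOpposite S → Weightable T
  hasOpposite⇒weightable {value} {T} S (r , opposite≈0) =
    relabel-weightable T r
      (opposite⇒weightable (relabel-consistent r S) (rename≈0 value r αβδ opposite≈0))

  -- A vertex with `β` yields an opposite pair, or a double relation; the latter is renamed to `ββγ`
  -- and leads to an opposite pair through the vertices with `δ` and `ε`.
  weightable : ∀ {value T} → Consistent value T → Weightable T
  weightable {value} {T} S = let c , β∈ = Consistent.occurs S β in
    forced _ (⟦total⟧≈0 S free (Vec.toList (T c)) real (Consistent.vertex-sum S c))
      (forces-opposite-or-double (T c) β∈)
    where
    real = free-realises S
    forced : ∀ f → ⟦ f ⟧ basis S ≈ 0# → ForcesOppositeOrDouble f → Weightable T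
    forced f f≈0 (inj₁ forces)  = hasOpposite⇒weightable S (forced-opposite S free f real f≈0 forces)
    forced f f≈0 (inj₂ ∥double) = let r , f∥double = Any.satisfied ∥double ; S′ = relabel-consistent r S in
      relabel-weightable T r (hasOpposite⇒weightable S′ (double⇒opposite S′
        (rename≈0 value r ββγ (parallel-sum≈0 S free f (double r) real f≈0 f∥double))))

-- The search

Word : Set
Word = Vec Name 5

words : List Word
words = List.filter covers? (vectors names 5)

rotate : {A : Set} → Vec A 5 → Vec A 5
rotate (x ∷ xs) = xs Vec.∷ʳ x

dihedral : {A : Set} → Vec A 5 → List (Vec A 5)
dihedral w = List.iterate rotate w 5 ++ List.iterate rotate (Vec.reverse w) 5

infixl 9 _!?_
_!?_ : ∀ {A : Set} {n} → List A → Fin n → Maybe A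
[]       !? i     = nothing
(x ∷ xs) !? zero  = just x
(x ∷ xs) !? suc i = xs !? i

-- A partial tiling is the list of the words of P₁, P₂, … placed so far.
known : List Word → Corner → Maybe Name
known ws (i , k) = Maybe.map (λ w → lookup w k) (ws !? i)

knownWeight : (Corner → Maybe Name) → List Corner → ℤ
knownWeight f []       = + 0
knownWeight f (c ∷ cs) = maybe weight (+ 0) (f c) ℤ.+ knownWeight f cs

slack : (Corner → Maybe Name) → List Corner → ℕ
slack f []       = 0
slack f (c ∷ cs) = maybe (λ _ → 0) 2 (f c) ℕ.+ slack f cs

-- Weights are at most 2 in absolute value, so this is necessary for the corners
-- not yet named to bring the weight to 0.
Feasible : (Corner → Maybe Name) → List Corner → Set
Feasible f cs = ∣ knownWeight f cs ∣ ≤ slack f cs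

feasible? : ∀ f cs → Dec (Feasible f cs)
feasible? f cs = ∣ knownWeight f cs ∣ ≤? slack f cs

-- The five vertices of the tile placed at this step, the only ones where a new corner becomes
-- known. `P₁` is the root of the search and has no stage.
stage : Fin 11 → List (List Corner)
stage i = List.map (λ k → cornersAt (vertex (suc i , k))) (List.allFin 5)

-- The stages, and later the symmetries, are parameters so that evaluation
-- shares them.
search : List (List (List Corner)) → List Word → List Word → List (List Word)
search []            candidates ws = ws ∷ []
search (vs ∷ stages) candidates ws = List.concatMap (search stages candidates)
  (List.filter (λ ws′ → All.all? (feasible? (known ws′)) vs) (List.map (ws ∷ʳ_) candidates))

solutions : List Word → List (List (List Corner)) → List (List Word)
solutions roots stages = List.concatMap (λ w → search stages (dihedral w) (w ∷ [])) roots

∣weight∣≤2 : ∀ x → ∣ weight x ∣ ≤ 2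
∣weight∣≤2 α = z≤n
∣weight∣≤2 β = s≤s z≤n
∣weight∣≤2 γ = s≤s (s≤s z≤n)
∣weight∣≤2 δ = s≤s z≤n
∣weight∣≤2 ε = s≤s (s≤s z≤n)

_⊑_ : (Corner → Maybe Name) → (Corner → Name) → Set
f ⊑ n = ∀ c {x} → f c ≡ just x → n c ≡ x

-- A known corner contributes equally to both sums and cancels; an unknown one contributes at most
-- 2, by the triangle inequality.
knownWeight-error : ∀ {f n} → f ⊑ n → ∀ cs →
  ∣ knownWeight f cs ℤ.- weightSum (List.map n cs) ∣ ≤ slack f cs
knownWeight-error         f⊑n []       = z≤n
knownWeight-error {f} {n} f⊑n (c ∷ cs) with f c in fc≡
... | just x = subst (λ i → ∣ i ∣ ≤ slack f cs)
  (trans (cancel (weight x) K S)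
    (cong (λ y → (weight x ℤ.+ K) ℤ.- (weight y ℤ.+ S)) (sym (f⊑n c fc≡))))
  (knownWeight-error f⊑n cs)
  where
  K = knownWeight f cs
  S = weightSum (List.map n cs)
  cancel : ∀ i k s → k ℤ.- s ≡ (i ℤ.+ k) ℤ.- (i ℤ.+ s)
  cancel = solve-∀
... | nothing = begin
  ∣ (+ 0 ℤ.+ K) ℤ.- (weight (n c) ℤ.+ S) ∣     ≡⟨ cong ∣_∣ (rearrange (weight (n c)) K S) ⟩
  ∣ ℤ.- weight (n c) ℤ.+ (K ℤ.- S) ∣           ≤⟨ ℤ.∣i+j∣≤∣i∣+∣j∣ (ℤ.- weight (n c)) (K ℤ.- S) ⟩
  ∣ ℤ.- weight (n c) ∣ ℕ.+ ∣ K ℤ.- S ∣         ≤⟨ ℕ.+-mono-≤ ∣-weight∣≤2 (knownWeight-error f⊑n cs) ⟩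
  2 ℕ.+ slack f cs                             ∎
  where
  open ℕ.≤-Reasoning
  K = knownWeight f cs
  S = weightSum (List.map n cs)
  ∣-weight∣≤2 = ℕ.≤-trans (ℕ.≤-reflexive (ℤ.∣-i∣≡∣i∣ (weight (n c)))) (∣weight∣≤2 (n c))
  rearrange : ∀ i k s → (+ 0 ℤ.+ k) ℤ.- (i ℤ.+ s) ≡ ℤ.- i ℤ.+ (k ℤ.- s)
  rearrange = solve-∀

⊑⇒feasible : ∀ {f n} → f ⊑ n → ∀ cs → weightSum (List.map n cs) ≡ + 0 → Feasible f cs
⊑⇒feasible {f} {n} f⊑n cs sum≡0 = subst (λ i → ∣ i ∣ ≤ slack f cs)
  (trans (cong (λ i → knownWeight f cs ℤ.- i) sum≡0) (ℤ.+-identityʳ (knownWeight f cs)))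
  (knownWeight-error f⊑n cs)

!?-++ : ∀ {A : Set} {m} (xs : List A) {ys} (i : Fin m) {x} →
  xs !? i ≡ just x → (xs ++ ys) !? i ≡ just x
!?-++ (_ ∷ xs) zero    eq = eq
!?-++ (_ ∷ xs) (suc i) eq = !?-++ xs i eq

tabulate-!? : ∀ {A : Set} {m} (f : Fin m → A) i → List.tabulate f !? i ≡ just (f i)
tabulate-!? f zero    = refl
tabulate-!? f (suc i) = tabulate-!? (f ∘ suc) i

known-++ : ∀ xs {ys} c {x} → known xs c ≡ just x → known (xs ++ ys) c ≡ just x
known-++ xs (i , k) eq with xs !? i in xs!?i≡
known-++ xs {ys} (i , k) eq | just w rewrite !?-++ xs {ys} i xs!?i≡ = eq

-- Every prefix of the tiling is feasible, so its branch is never pruned.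
search-complete : ∀ {cand} stages xs ys → length stages ≡ length ys → All (_∈ cand) ys →
  (∀ zs {zs′} → zs ++ zs′ ≡ xs ++ ys → All (All (Feasible (known zs))) stages) →
  xs ++ ys ∈ search stages cand xs
search-complete []            xs []       _  _  _    = here (List.++-identityʳ xs)
search-complete {cand} (vs ∷ stages) xs (y ∷ ys) eq (y∈ ∷ ys∈) feasible =
  ∈-concatMap⁺ (search stages cand) {xs = List.filter fits? (List.map (xs ∷ʳ_) cand)} (lose
    (∈-filter⁺ fits? (∈-map⁺ (xs ∷ʳ_) y∈) (All.head (feasible (xs ∷ʳ y) {ys} reassoc)))
    (subst (_∈ search stages cand (xs ∷ʳ y)) reassoc
      (search-complete stages (xs ∷ʳ y) ys (ℕ.suc-injective eq) ys∈
        λ zs eq′ → All.tail (feasible zs (trans eq′ reassoc)))))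
  where
  fits? = λ ws → All.all? (feasible? (known ws)) vs
  reassoc : (xs ∷ʳ y) ++ ys ≡ xs ++ y ∷ ys
  reassoc = List.++-assoc xs (y ∷ []) ys

-- Matching the solutions with the four tilings

involution : (f : Vec (Fin 12) 12) →
  {True (Fin.all? λ i → lookup f (lookup f i) Fin.≟ i)} → Permutation′ 12
involution f {inv} = permutation (lookup f) (lookup f) (toWitness inv) (toWitness inv)

mirror₁ mirror₂ antipode halfTurn : Permutation′ 12
mirror₁  = involution (P₁ ∷ P₂ ∷ P₆ ∷ P₅ ∷ P₄ ∷ P₃ ∷ P₁₁ ∷ P₁₀ ∷ P₉ ∷ P₈ ∷ P₇ ∷ P₁₂ ∷ [])
mirror₂  = involution (P₁ ∷ P₃ ∷ P₂ ∷ P₆ ∷ P₅ ∷ P₄ ∷ P₇ ∷ P₁₁ ∷ P₁₀ ∷ P₉ ∷ P₈ ∷ P₁₂ ∷ [])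
antipode = involution (P₁₂ ∷ P₉ ∷ P₁₀ ∷ P₁₁ ∷ P₇ ∷ P₈ ∷ P₅ ∷ P₆ ∷ P₂ ∷ P₃ ∷ P₄ ∷ P₁ ∷ [])
halfTurn = involution (P₂ ∷ P₁ ∷ P₆ ∷ P₁₁ ∷ P₇ ∷ P₃ ∷ P₅ ∷ P₁₀ ∷ P₁₂ ∷ P₈ ∷ P₄ ∷ P₉ ∷ [])

-- The stabiliser D₅ of P₁ is generated by the two mirrors.  The antipode and
-- the half turn about the edge E₁₂, followed by a rotation about P₁, carry P₁
-- to every tile, so the products are all 120 symmetries.
rotations stabiliser transversal tilePermutations : List (Permutation′ 12)
rotations   = List.iterate (λ π → mirror₁ ∘ₚ mirror₂ ∘ₚ π) Perm.id 5
stabiliser  = List.concatMap (λ π → π ∷ (mirror₁ ∘ₚ π) ∷ []) rotations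
transversal = Perm.id ∷ List.map (halfTurn ∘ₚ_) rotations
tilePermutations = List.concatMap (λ π → π ∷ (antipode ∘ₚ π) ∷ [])
  (List.cartesianProductWith _∘ₚ_ stabiliser transversal)

-- The image of a corner is located by its vertex and the outcome is then tested, so the default
-- `zero` in `find` is never trusted.
symmetry? : Permutation′ 12 → Maybe Symmetry
symmetry? π = build (Vec.tabulate λ i → Vec.tabulate λ k → find (π ⟨$⟩ʳ i) (target i k))
  where
  target : Fin 12 → Fin 5 → Vertex
  target i k = V (π ⟨$⟩ʳ i) (π ⟨$⟩ʳ nbr i k) (π ⟨$⟩ʳ nbr i (next k))

  find : Fin 12 → Vertex → Fin 5
  find i v = Maybe.fromMaybe zero
    (List.head (List.filter (λ k → vertex (i , k) ≟ⱽ v) (List.allFin 5)))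

  build : Vec (Vec (Fin 5) 5) 12 → Maybe Symmetry
  build index = Maybe.map
    (λ p → record { tile = π ; index = λ i k → lookup (lookup index i) k ; vertex-preserving = p })
    (dec⇒maybe (Fin.all? λ i → Fin.all? λ k →
      vertex (π ⟨$⟩ʳ i , lookup (lookup index i) k) ≟ⱽ target i k))

symmetries : List Symmetry
symmetries = List.mapMaybe symmetry? tilePermutations

-- The weights are negated by β ↔ δ, γ ↔ ε.
weightSymmetries : List Renaming
weightSymmetries = renamingBy Perm.id
  ∷ renamingBy (transpose zero (suc (suc zero)) ∘ₚ transpose (suc zero) (suc (suc (suc zero))))
  ∷ []

nameCombination : List (List Name)
nameCombination =
     List.replicate 2 (α ∷ α ∷ α ∷ [])
  ++ List.replicate 6 (α ∷ γ ∷ ε ∷ [])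
  ++ List.replicate 6 (β ∷ β ∷ γ ∷ [])
  ++ List.replicate 6 (δ ∷ δ ∷ ε ∷ [])

open Permutation (≡.setoid Name) using () renaming (_↭_ to _↭ᴺ_; ↭-setoid to ↭ᴺ-setoid)
open Permutation ↭ᴺ-setoid using () renaming (_↭_ to _↭↭ᴺ_)
open DecPermutation (≡.decSetoid _≟_) using () renaming (_↭?_ to _↭ᴺ?_; ↭-decSetoid to ↭ᴺ-decSetoid)
open DecPermutation ↭ᴺ-decSetoid using () renaming (_↭?_ to _↭↭ᴺ?_)

Matches : List Word → Renaming → Words → Symmetry → Set
Matches ws r t s = All
  (λ c → known ws (Symmetry.corner s c) ≡ just (Renaming.rename r (angleName t c))) corners

matches? : ∀ ws r t s → Dec (Matches ws r t s)
matches? ws r t s = All.all? (λ c → Maybe.≡-dec _≟_ _ _) corners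

Solves : List (List Corner) → List Symmetry → List Word → Renaming → Set
Solves vs ss ws r =
  List.map (List.mapMaybe (known ws)) vs ↭↭ᴺ
    List.map (List.map (Renaming.rename r)) nameCombination
  × Any (λ t → Any (Matches ws r t) ss) (tiling-i ∷ tiling-ii ∷ tiling-iii ∷ tiling-iv ∷ [])

solves? : ∀ vs ss ws r → Dec (Solves vs ss ws r)
solves? vs ss ws r =
  (List.map (List.mapMaybe (known ws)) vs ↭↭ᴺ?
    List.map (List.map (Renaming.rename r)) nameCombination)
  ×-dec Any.any? (λ t → Any.any? (matches? ws r t) ss) _

allSolved? : ∀ vs ss wss → Dec (All (λ ws → Any (Solves vs ss ws) weightSymmetries) wss)
allSolved? vs ss = All.all? λ ws → Any.any? (solves? vs ss ws) weightSymmetries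

abstract
  -- The main computation: evaluation checks every leaf of the search for both the vertex
  -- combination and a match with one of the four tilings, under the same renaming.
  solutions-solved :
    All (λ ws → Any (Solves (List.map cornersAt vertices) symmetries ws) weightSymmetries)
      (solutions words (List.tabulate stage))
  solutions-solved = from-yes
    (allSolved? (List.map cornersAt vertices) symmetries (solutions words (List.tabulate stage)))

-- Finite facts about the pattern and about pentagons

_≟ᶜ_ : DecidableEquality Corner
_≟ᶜ_ = ×.≡-dec Fin._≟_ Fin._≟_

open Permutation (≡.setoid Corner) using () renaming (_↭_ to _↭ᶜ_)
open DecPermutation (≡.decSetoid _≟ᶜ_) using () renaming (_↭?_ to _↭ᶜ?_)

cornersOf : Fin 12 → List Corner
cornersOf i = List.map (i ,_) (List.allFin 5)

abstract
  -- Each of the 60 corners lies at one vertex and in one tile; this is the basis of the double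
  -- count.
  vertices-and-tiles-partition :
    List.concat (List.map cornersAt vertices) ↭ᶜ List.concat (List.map cornersOf (List.allFin 12))
  vertices-and-tiles-partition = from-yes
    (List.concat (List.map cornersAt vertices) ↭ᶜ? List.concat (List.map cornersOf (List.allFin 12)))

  vertices-of-corners : All (λ v → Any (λ c → v ≡ vertex c) corners) vertices
  vertices-of-corners = from-yes (All.all? (λ v → Any.any? (λ c → v ≟ⱽ vertex c) corners) vertices)

  vertices-have-degree-3 : All (λ c → length (cornersAt (vertex c)) ≡ 3) corners
  vertices-have-degree-3 = from-yes (All.all? (λ c → length (cornersAt (vertex c)) ℕ.≟ 3) corners)

  words-↭-names : All (λ w → Vec.toList w ↭ᴺ names) words
  words-↭-names = from-yes (All.all? (λ w → Vec.toList w ↭ᴺ? names) words)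

∀ᶠ? : ∀ {p n} {P : Fin n → Set p} → Decidable P → Dec (∀ x → P x)
∀ᶠ? = exhaust? ∈-allFin

Adjacent : Fin 5 → Fin 5 → Set
Adjacent e f = f ≡ next e ⊎ e ≡ next f

adjacent? : ∀ e f → Dec (Adjacent e f)
adjacent? e f = (f Fin.≟ next e) ⊎-dec (e Fin.≟ next f)

meet : Fin 5 → Fin 5 → Fin 5
meet e f with f Fin.≟ next e
... | yes _ = e
-- For adjacent edges only `e ≡ next f` is left, and the corner then carries the index of `f`.
... | no _  = f

meetAt⇒adjacent : ∀ {e f k} → MeetAt e f k → Adjacent e f
meetAt⇒adjacent (inj₁ (refl , refl)) = inj₁ refl
meetAt⇒adjacent (inj₂ (refl , refl)) = inj₂ refl

meetAt⇒meet : ∀ {e f k} → MeetAt e f k → k ≡ meet e f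
meetAt⇒meet (inj₁ (refl , refl)) = from-yes (∀ᶠ? λ k → k Fin.≟ meet k (next k)) _
meetAt⇒meet (inj₂ (refl , refl)) = from-yes (∀ᶠ? λ k → k Fin.≟ meet (next k) k) _

indices : Vec (Fin 5) 5
indices = Vec.allFin 5

abstract
  -- A closed walk of five steps on the 5-cycle that does not turn back runs once around it, in one
  -- direction or the other. Interleaving the premises with the quantifiers prunes the exhaustive
  -- check early.
  meets-dihedral : ∀ a b → Adjacent a b → ∀ c → a ≢ c → Adjacent b c → ∀ d → b ≢ d → Adjacent c d →
    ∀ e → c ≢ e → Adjacent d e → Adjacent e a →
    meet a b ∷ meet b c ∷ meet c d ∷ meet d e ∷ meet e a ∷ [] ∈ dihedral indices
  meets-dihedral = from-yes (∀ᶠ? λ a → ∀ᶠ? λ b → adjacent? a b →-dec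
    ∀ᶠ? λ c → ¬? (a Fin.≟ c) →-dec adjacent? b c →-dec
    ∀ᶠ? λ d → ¬? (b Fin.≟ d) →-dec adjacent? c d →-dec
    ∀ᶠ? λ e → ¬? (c Fin.≟ e) →-dec adjacent? d e →-dec adjacent? e a →-dec
    Any.any? (Vec.≡-dec Fin._≟_ (meet a b ∷ meet b c ∷ meet c d ∷ meet d e ∷ meet e a ∷ []))
      (dihedral indices))

-- From angles to names

word : (Corner → Name) → Fin 12 → Word
word n i = Vec.tabulate λ k → n (i , k)

record CongruentWords (n : Corner → Name) : Set where
  field
    congruent : ∀ i j → ∃[ m ] Vec.tabulate m ∈ dihedral indices × (∀ k → n (i , k) ≡ n (j , m k))
    covers    : ∀ i x → ∃[ k ] n (i , k) ≡ x

  word∈dihedral : ∀ i j → word n i ∈ dihedral (word n j)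
  word∈dihedral i j with congruent i j
  ... | m , m∈ , n≡ = subst (_∈ dihedral (word n j))
    (trans (sym (Vec.tabulate-∘ (λ k → n (j , k)) m)) (Vec.tabulate-cong (sym ∘ n≡)))
    (∈-map⁺ (Vec.map λ k → n (j , k)) m∈)

  word∈words : ∀ i → word n i ∈ words
  word∈words i = ∈-filter⁺ covers? (∈-vectors ∈-names (word n i))
    λ x → let k , n≡x = covers i x in
      subst (_∈ Vec.toList (word n i)) n≡x (∈-toList (λ k → n (i , k)) k)
    where
    ∈-toList : ∀ {m} (f : Fin m → Name) k → f k ∈ Vec.toList (Vec.tabulate f)
    ∈-toList f zero    = here refl
    ∈-toList f (suc k) = there (∈-toList (f ∘ suc) k)

unrename-congruent : ∀ {n} r → CongruentWords n → CongruentWords (unrename r ∘ n)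
unrename-congruent r C = record
  { congruent = λ i j → let m , m∈ , n≡ = congruent i j in m , m∈ , λ k → cong (unrename r) (n≡ k)
  ; covers    = λ i x → let k , n≡ = covers i (Renaming.rename r x) in
      k , trans (cong (unrename r) n≡) (unrename-rename r x)
  }
  where open CongruentWords C

known-tabulate : ∀ n c → known (List.tabulate (word n)) c ≡ just (n c)
known-tabulate n (i , k) rewrite tabulate-!? (word n) i =
  cong just (Vec.lookup∘tabulate (λ k → n (i , k)) k)

known-prefix : ∀ n {ws ws′} → ws ++ ws′ ≡ List.tabulate (word n) → known ws ⊑ n
known-prefix n {ws} eq c {x} k≡x = Maybe.just-injective
  (trans (sym (known-tabulate n c)) (trans (cong (λ ws → known ws c) (sym eq)) (known-++ ws c k≡x)))

solutions-complete : ∀ roots stages {w ws} → w ∈ roots → ws ∈ search stages (dihedral w) (w ∷ []) →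
  ws ∈ solutions roots stages
solutions-complete roots stages w∈ ws∈ =
  ∈-concatMap⁺ (λ w → search stages (dihedral w) (w ∷ [])) (Any.map (λ { refl → ws∈ }) w∈)

-- The word of `P₁` is the root, congruence puts the other words among its dihedral images, and
-- vertices of weight 0 make every prefix feasible.
words∈solutions : ∀ {n} → CongruentWords n →
  (∀ c → weightSum (List.map n (cornersAt (vertex c))) ≡ + 0) →
  List.tabulate (word n) ∈ solutions words (List.tabulate stage)
words∈solutions {n} C zero-sum = solutions-complete words (List.tabulate stage) (word∈words P₁)
  (search-complete (List.tabulate stage) (word n P₁ ∷ []) (List.tabulate (word n ∘ suc)) refl
    (All.tabulate⁺ (λ i → word∈dihedral (suc i) P₁))
    (λ zs {zs′} eq → All.tabulate⁺ {f = stage} (λ i → stage-feasible zs eq i)))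
  where
  open CongruentWords C
  stage-feasible : ∀ zs {zs′} → zs ++ zs′ ≡ List.tabulate (word n) →
    ∀ i → All (Feasible (known zs)) (stage i)
  stage-feasible zs {zs′} eq i = All.map⁺ {f = λ k → cornersAt (vertex (suc i , k))} (All.universal
    (λ k → ⊑⇒feasible (known-prefix n {zs} {zs′} eq) (cornersAt (vertex (suc i , k))) (zero-sum (suc i , k)))
    (List.allFin 5))

-- Double counting, and passing from a tiling by angles to a tiling by names.

module Names {c ℓ₁ ℓ₂ ℓ₃} (F : OrderedField c ℓ₁ ℓ₂ ℓ₃) where
  open Relations F
  open IntegerMultiples F using (·-torsion-free; ·-zeroʳ)
  open Angles F
  open OrderedField F using (commutativeRing)
  open CommutativeRing commutativeRing hiding (zero)
    renaming (refl to ≈-refl; sym to ≈-sym; trans to ≈-trans; reflexive to ≈-reflexive)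
  open import Algebra.Properties.AbelianGroup +-abelianGroup using (∙-cancelʳ)
  open import Algebra.Properties.CommutativeSemigroup +-commutativeSemigroup using (interchange)
  open import Relation.Binary.Reasoning.Setoid setoid

  sum-++ : ∀ xs ys → sum (xs ++ ys) ≈ sum xs + sum ys
  sum-++ []       ys = ≈-sym (+-identityˡ _)
  sum-++ (x ∷ xs) ys = ≈-trans (+-congˡ (sum-++ xs ys)) (≈-sym (+-assoc _ _ _))

  sum-cong : ∀ {A : Set} {f g : A → Carrier} → (∀ x → f x ≈ g x) →
    ∀ xs → sum (List.map f xs) ≈ sum (List.map g xs)
  sum-cong f≈g []       = ≈-refl
  sum-cong f≈g (x ∷ xs) = +-cong (f≈g x) (sum-cong f≈g xs)

  sum-↭ : ∀ {A : Set} (f : A → Carrier) {xs ys} → Permutation._↭_ (≡.setoid A) xs ys →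
    sum (List.map f xs) ≈ sum (List.map f ys)
  sum-↭ {A} f xs↭ys = Permutationₚ.foldr-commMonoid setoid +-isCommutativeMonoid
    (Permutationₚ.map⁺ (≡.setoid A) setoid {f} (λ { refl → ≈-refl }) xs↭ys)

  sum-concat : ∀ {A : Set} (f : A → Carrier) {s} {xss} → All (λ xs → sum (List.map f xs) ≈ s) xss →
    sum (List.map f (List.concat xss)) ≈ length xss · s
  sum-concat f []                       = ≈-refl
  sum-concat f {s} {xs ∷ xss} (xs≈ ∷ xss≈) = begin
    sum (List.map f (xs ++ List.concat xss))                      ≡⟨ cong sum (List.map-++ f xs (List.concat xss)) ⟩
    sum (List.map f xs ++ List.map f (List.concat xss))           ≈⟨ sum-++ (List.map f xs) _ ⟩
    sum (List.map f xs) + sum (List.map f (List.concat xss))      ≈⟨ +-cong xs≈ (sum-concat f xss≈) ⟩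
    s + length xss · s                                            ∎

  double-count : ∀ {A : Set} (f : A → Carrier) {s} xss yss →
    Permutation._↭_ (≡.setoid A) (List.concat xss) (List.concat yss) →
    All (λ xs → sum (List.map f xs) ≈ 0#) xss → All (λ ys → sum (List.map f ys) ≈ s) yss →
    length yss · s ≈ 0#
  double-count f {s} xss yss xss↭yss xss≈ yss≈ = begin
    length yss · s                       ≈⟨ sum-concat f yss≈ ⟨
    sum (List.map f (List.concat yss))   ≈⟨ sum-↭ f xss↭yss ⟨
    sum (List.map f (List.concat xss))   ≈⟨ sum-concat f xss≈ ⟩
    length xss · 0#                      ≈⟨ ·-zeroʳ (length xss) ⟩
    0#                                   ∎

  deviationSum-value : ∀ value xs →
    deviationSum value xs + length xs · value α ≈ sum (List.map value xs)
  deviationSum-value value []       = +-identityˡ _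
  deviationSum-value value (x ∷ xs) = begin
    (value x - value α + deviationSum value xs) + (value α + length xs · value α)
      ≈⟨ interchange _ _ _ _ ⟩
    (value x - value α + value α) + (deviationSum value xs + length xs · value α)
      ≈⟨ +-cong (≈-trans (+-assoc _ _ _) (≈-trans (+-congˡ (-‿inverseˡ _)) (+-identityʳ _)))
           (deviationSum-value value xs) ⟩
    value x + sum (List.map value xs)  ∎

  module ↭ = Permutation setoid
  module ↭↭ = Permutation ↭.↭-setoid

  module _ {angle : Assignment} {value : Name → Carrier} (r₀ : Renaming) (n : Corner → Name)
           (angle≈ : ∀ c → angle c ≈ value (Renaming.rename r₀ (n c))) where

    ws : List Word
    ws = List.tabulate (word n)

    value₀ : Name → Carrier
    value₀ = value ∘ Renaming.rename r₀

    given : ∀ {ss} r t → Any (Matches ws r t) ss → GivenBy angle (value ∘ Renaming.rename (r₀ ∘ᴿ r)) t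
    given r t matching = let s , matches = Any.satisfied matching in s , λ c →
      ≈-trans (angle≈ (Symmetry.corner s c)) (≈-reflexive (cong value₀ (Maybe.just-injective
        (trans (sym (known-tabulate n (Symmetry.corner s c))) (All.lookup matches (∈-corners c))))))

    map-angle : ∀ cs → Pointwise _≈_ (List.map angle cs) (List.map value₀ (List.mapMaybe (known ws) cs))
    map-angle []       = []
    -- All twelve tiles are placed, so `known` always succeeds and `mapMaybe` drops no corner.
    map-angle (c ∷ cs) rewrite known-tabulate n c = angle≈ c ∷ map-angle cs

    map-anglesAt : ∀ vs → Pointwise ↭._↭_ (List.map (anglesAt angle) vs)
      (List.map (List.map value₀) (List.map (List.mapMaybe (known ws)) (List.map cornersAt vs)))
    map-anglesAt []       = []
    map-anglesAt (v ∷ vs) = ↭.refl (map-angle (cornersAt v)) ∷ map-anglesAt vs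

    combination : ∀ r vs →
      List.map (List.mapMaybe (known ws)) (List.map cornersAt vs) ↭↭ᴺ
        List.map (List.map (Renaming.rename r)) nameCombination →
      List.map (anglesAt angle) vs ↭↭.↭ vertexCombination (value ∘ Renaming.rename (r₀ ∘ᴿ r))
    -- `vertexCombination` for the composed renaming computes to `nameCombination` mapped first by
    -- `r` and then by `value₀`.
    combination r vs vs↭ = ↭↭.trans (↭↭.refl (map-anglesAt vs))
      (Permutationₚ.map⁺ ↭ᴺ-setoid ↭.↭-setoid
        (Permutationₚ.map⁺ (≡.setoid Name) setoid {value₀} λ { refl → ≈-refl }) vs↭)

    conclude : ∀ {ss} vs → Any (Solves (List.map cornersAt vs) ss ws) weightSymmetries →
      Σ[ r ∈ Renaming ]
      List.map (anglesAt angle) vs ↭↭.↭ vertexCombination (value ∘ Renaming.rename r)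
      × ( GivenBy angle (value ∘ Renaming.rename r) tiling-i
        ⊎ GivenBy angle (value ∘ Renaming.rename r) tiling-ii
        ⊎ GivenBy angle (value ∘ Renaming.rename r) tiling-iii
        ⊎ GivenBy angle (value ∘ Renaming.rename r) tiling-iv )
    conclude vs solves = let r , comb , matching = Any.satisfied solves in
      r₀ ∘ᴿ r , combination r vs comb , any₄ (Any.map (λ {t} → given r t) matching)

  module Tiling {π : Carrier} {angle : Assignment} {value : Name → Carrier}
           (tiling : IsAngleCongruentTiling π angle) (hasAngles : HasAngles angle value)
           (3α≈2π : 3 · value α ≈ 2 · π) (distinct : Distinct value) where
    open IsAngleCongruentTiling tiling
    open HasAngles hasAngles

    name : Corner → Name
    name c = proj₁ (named c)

    angle≈ : ∀ c → angle c ≈ value (name c)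
    angle≈ c = proj₂ (named c)

    -- `Distinct` only refutes equalities; decidability of equality of names turns this into
    -- injectivity.
    value-injective : ∀ {x y} → value x ≈ value y → x ≡ y
    value-injective {x} {y} eq = decidable-stable (x ≟ y) λ x≢y → distinct x≢y eq

    congruent-tiles : ∀ i j →
      ∃[ m ] Vec.tabulate m ∈ dihedral indices × (∀ k → name (i , k) ≡ name (j , m k))
    congruent-tiles i j = m
      , subst (_∈ dihedral indices) (Vec.tabulate-cong met)
        -- `P₁` to `P₅` stand here for the elements of `Fin 5`, the edges of the pentagon.
        -- Injectivity of `f` keeps the walk through the image edges from turning back.
        (meets-dihedral _ _ (adjacent P₁) _ (apart P₁ P₃ λ ()) (adjacent P₂) _ (apart P₂ P₄ λ ())
          (adjacent P₃) _ (apart P₃ P₅ λ ()) (adjacent P₄) (adjacent P₅))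
      , λ k → value-injective (≈-trans (≈-sym (angle≈ (i , k)))
        (≈-trans (proj₂ (proj₂ (match k))) (angle≈ (j , m k))))
      where
      f = proj₁ (congruent i j)
      match = proj₂ (congruent i j)
      m : Fin 5 → Fin 5
      m k = proj₁ (match k)
      met : ∀ k → meet (f ⟨$⟩ʳ k) (f ⟨$⟩ʳ next k) ≡ m k
      met k = sym (meetAt⇒meet (proj₁ (proj₂ (match k))))
      adjacent : ∀ k → Adjacent (f ⟨$⟩ʳ k) (f ⟨$⟩ʳ next k)
      adjacent k = meetAt⇒adjacent {k = m k} (proj₁ (proj₂ (match k)))
      apart : ∀ k l → k ≢ l → f ⟨$⟩ʳ k ≢ f ⟨$⟩ʳ l
      apart k l k≢l eq = k≢l (trans (sym (inverseˡ f)) (trans (cong (f ⟨$⟩ˡ_) eq) (inverseˡ f)))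

    congruentWords : CongruentWords name
    congruentWords = record
      { congruent = congruent-tiles
      -- A name that occurs in some tile `j` is carried into tile `i` by the congruence.
      ; covers    = λ i x →
          let (j , k) , angle≈x = occurs x
              m , _ , n≡ = congruent-tiles j i
          in m k , trans (sym (n≡ k)) (value-injective (≈-trans (≈-sym (angle≈ (j , k))) angle≈x))
      }

    open CongruentWords congruentWords using (word∈words)

    triple : ∀ c → ∃[ t ] Vec.toList {n = 3} t ≡ List.map name (cornersAt (vertex c))
    triple c = sized 3 _ (trans (List.length-map name (cornersAt (vertex c)))
      (All.lookup vertices-have-degree-3 (∈-corners c)))

    -- The three angles sum to 2π, which is three times the value of `α`, so subtracting that value
    -- from each leaves 0.
    vertex-deviation : ∀ c → deviationSum value (List.map name (cornersAt (vertex c))) ≈ 0#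
    vertex-deviation c = ∙-cancelʳ (3 · value α) _ _ (begin
      deviationSum value xs + 3 · value α           ≡⟨ cong (λ l → deviationSum value xs + l · value α) length≡3 ⟨
      deviationSum value xs + length xs · value α   ≈⟨ deviationSum-value value xs ⟩
      sum (List.map value xs)                       ≡⟨ cong sum (sym (List.map-∘ cs)) ⟩
      sum (List.map (value ∘ name) cs)              ≈⟨ sum-cong angle≈ cs ⟨
      sum (List.map angle cs)                       ≈⟨ vertex-sum c ⟩
      2 · π                                         ≈⟨ 3α≈2π ⟨
      3 · value α                                   ≈⟨ +-identityˡ _ ⟨
      0# + 3 · value α                              ∎)
      where
      cs = cornersAt (vertex c)
      xs = List.map name cs
      length≡3 : length xs ≡ 3
      length≡3 = trans (List.length-map name cs) (All.lookup vertices-have-degree-3 (∈-corners c))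

    cornerDeviation : Corner → Carrier
    cornerDeviation = deviation value ∘ name

    map-cornerDeviation : ∀ cs → sum (List.map cornerDeviation cs) ≡ deviationSum value (List.map name cs)
    map-cornerDeviation cs = cong sum (List.map-∘ cs)

    12·names≈0 : 12 · deviationSum value names ≈ 0#
    12·names≈0 = double-count cornerDeviation (List.map cornersAt vertices)
        (List.map cornersOf (List.allFin 12)) vertices-and-tiles-partition by-vertex by-tile
      where
      by-tile : All (λ cs → sum (List.map cornerDeviation cs) ≈ deviationSum value names)
        (List.map cornersOf (List.allFin 12))
      by-tile = All.map⁺ {f = cornersOf} (All.universal
        (λ i → sum-↭ (deviation value) (All.lookup words-↭-names (word∈words i))) (List.allFin 12))
      at-vertex : ∀ {v} → Any (λ c → v ≡ vertex c) corners →
        sum (List.map cornerDeviation (cornersAt v)) ≈ 0#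
      at-vertex v∈ = let c , v≡ = Any.satisfied v∈ in
        subst (λ v → sum (List.map cornerDeviation (cornersAt v)) ≈ 0#) (sym v≡)
          (≈-trans (≈-reflexive (map-cornerDeviation (cornersAt (vertex c)))) (vertex-deviation c))
      by-vertex : All (λ cs → sum (List.map cornerDeviation cs) ≈ 0#) (List.map cornersAt vertices)
      by-vertex = All.map⁺ {f = cornersAt} (All.map at-vertex vertices-of-corners)

    consistent : Consistent value (proj₁ ∘ triple)
    consistent = record
      { distinct   = distinct
      -- A list of five entries that exhausts the names is one of `words`, hence a permutation of
      -- `names`.
      ; pentagon   = λ xs len covers →
          let w , w≡xs = sized 5 xs len
              w∈words = ∈-filter⁺ covers? (∈-vectors ∈-names w)
                λ x → subst (x ∈_) (sym w≡xs) (covers x)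
          in ≈-trans (≈-reflexive (cong (deviationSum value) (sym w≡xs)))
            (≈-trans (sum-↭ (deviation value) (All.lookup words-↭-names w∈words))
              -- The multiple in `·-torsion-free` is a successor, so 11 stands for the twelve tiles.
              (·-torsion-free 11 12·names≈0))
      ; vertex-sum = λ c → ≈-trans
          (≈-reflexive (cong (deviationSum value) (proj₂ (triple c)))) (vertex-deviation c)
      ; occurs     = λ x → let c , angle≈x = occurs x in
          c , subst₂ _∈_ (value-injective (≈-trans (≈-sym (angle≈ c)) angle≈x)) (sym (proj₂ (triple c)))
            (∈-map⁺ name (∈-filter⁺ (λ d → vertex d ≟ⱽ vertex c) (∈-corners c) refl))
      }

    relabelling : Renaming
    relabelling = proj₁ (weightable consistent)

    name′ : Corner → Name
    name′ = unrename relabelling ∘ name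

    zero-sum : ∀ c → weightSum (List.map name′ (cornersAt (vertex c))) ≡ + 0
    zero-sum c = trans (cong weightSum (trans (List.map-∘ (cornersAt (vertex c)))
        (trans (cong (List.map (unrename relabelling)) (sym (proj₂ (triple c))))
          (sym (Vec.toList-map (unrename relabelling) (proj₁ (triple c)))))))
      (proj₂ (weightable consistent) c)

    solved :
      Any (Solves (List.map cornersAt vertices) symmetries (List.tabulate (word name′))) weightSymmetries
    solved = All.lookup solutions-solved
      (words∈solutions (unrename-congruent relabelling congruentWords) zero-sum)

    angle≈′ : ∀ c → angle c ≈ value (Renaming.rename relabelling (name′ c))
    angle≈′ c = ≈-trans (angle≈ c) (≈-reflexive (cong value (sym (rename-unrename relabelling (name c)))))

proposition20 : ∀ {c ℓ₁ ℓ₂ ℓ₃} (F : OrderedField c ℓ₁ ℓ₂ ℓ₃) →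
    let open OrderedField F
        open Angles F
    in
    (π : Carrier) → 0# < π →
    (angle : Assignment) → IsAngleCongruentTiling π angle →
    (value : Name → Carrier) → HasAngles angle value →
    3 · value α ≈ 2 · π →
    Distinct value →
    Σ[ r ∈ Renaming ] let named = value ∘ Renaming.rename r in
      HasVertexCombination angle (vertexCombination named)
      × ( GivenBy angle named tiling-i
        ⊎ GivenBy angle named tiling-ii
        ⊎ GivenBy angle named tiling-iii
        ⊎ GivenBy angle named tiling-iv )
proposition20 F π _ angle tiling value hasAngles 3α≈2π distinct =
  conclude {value = value} relabelling name′ angle≈′ vertices solved
  where
  open Names F
  open Tiling tiling hasAngles 3α≈2π distinct
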